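{- Let $\mathbb{K}$ be any field. If $\mathcal{M}$ is a matroid on $[n]=\{1,\dots,n\}$ of corank at most two, then $T^2(\mathcal{M})=0$.
   Context: A matroid on $[n]$ is regarded as the simplicial complex $\mathcal{M}\subseteq 2^{[n]}$ of its independent sets: a nonempty family closed under taking subsets such that whenever $I,J\in\mathcal{M}$ with $\#J<\#I$ there is $v\in I\setminus J$ with $J\cup\{v\}\in\mathcal{M}$. If $\mathcal{M}$ has rank $r$ (the common cardinality of its maximal elements), its corank is $n-r$. Loops are allowed. For a simplicial complex $\Delta$ on $[n]$, $T^2(\Delta)$ is the second cotangent cohomology module of the Stanley-Reisner ring $S/I_\Delta$, where $S=\mathbb{K}[x_1,\dots,x_n]$ and $I=I_\Delta=\langle\prod_{i\in F}x_i : F\subseteq[n],\ F\notin\Delta\rangle$. Explicitly: let $m$ be the number of minimal monomial generators of $I$, let $d:S^m\to S$ be the $S$-linear map sending the canonical basis to these generators, $\operatorname{Syz}(I)=\ker d$, and $\operatorname{Kosz}(I)\subseteq\operatorname{Syz}(I)$ the submodule generated by all $d(f)g-d(g)f$ with $f,g\in S^m$. The quotient $\operatorname{Syz}(I)/\operatorname{Kosz}(I)$ is an $S/I$-module, and $T^2(\Delta)$ is the cokernel of the induced (restriction) map $\operatorname{Hom}_S(S^m,S/I)\to\operatorname{Hom}_{S/I}(\operatorname{Syz}(I)/\operatorname{Kosz}(I),S/I)$. -}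

module Defs where

open import Algebra.Apartness.Bundles using (HeytingField; HeytingCommutativeRing)
open import Algebra.Bundles using (AbelianGroup; CommutativeRing)
open import Algebra.Module.Bundles using (Module)
open import Algebra.Module.Construct.TensorUnit using (⟨module⟩)
open import Algebra.Module.Morphism.Structures using (module ModuleMorphisms)
open import Algebra.Module.Structures.Biased using (IsModuleFromLeft)
import Algebra.Properties.AbelianGroup as AbelianGroupProperties
import Algebra.Properties.CommutativeSemigroup as CommutativeSemigroupProperties
import Algebra.Properties.Ring as RingProperties
import Algebra.Properties.Semiring.Sum as SemiringSum
open import Data.Bool.Base using (true; false; if_then_else_)
open import Data.Empty using (⊥-elim)
open import Data.Fin.Base using (Fin)
open import Data.Fin.Subset using (Subset; inside; outside; _∈_; _∉_; _⊆_; _⊂_; _∪_; ⁅_⁆; ∣_∣)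
import Data.Fin.Subset.Properties as Sub
open import Data.List.Base as List using (List; []; _∷_; _++_; length)
import Data.List.Membership.Propositional as ListMem
open import Data.List.Membership.Propositional.Properties using (∈-++⁺ˡ; ∈-++⁺ʳ; ∈-map⁺; ∈-filter⁺; ∈-filter⁻; ∈-lookup)
open import Data.List.Properties using (length-filter; ++-assoc; ++-identityʳ)
import Data.List.Relation.Unary.Any as Any
open import Data.List.Relation.Unary.Any.Properties using (lookup-index)
open import Data.Nat.Base as ℕ using (ℕ; zero; suc; _∸_; _<_; _≤_; s≤s; z≤n)
open import Data.Nat.Induction using (<-wellFounded)
import Data.Nat.Properties as ℕₚ
open import Data.Sum.Base using (_⊎_; inj₁; inj₂)
open import Data.Product.Base using (Σ; ∃; ∃-syntax; _×_; _,_; proj₁; proj₂)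
open import Data.Vec.Base as Vec using (Vec; []; _∷_)
open import Data.Vec.Functional using (Vector)
open import Data.Vec.Properties using (≡-dec; zipWith-assoc; zipWith-comm; zipWith-identityˡ)
open import Function.Base using (_∘_; _$_)
open import Induction.WellFounded using (Acc; acc)
open import Level using (Level; _⊔_; 0ℓ) renaming (suc to lsuc)
open import Relation.Binary.PropositionalEquality as ≡ using (_≡_)
open import Relation.Nullary using (¬_; Dec; yes; no; does; ¬?; _×-dec_)
open import Relation.Unary using (Pred; Decidable)
import Relation.Binary.Reasoning.Setoid as SetoidReasoning

private variable
  r ℓr m m₁ m₂ ℓm ℓm₁ ℓm₂ p : Level

------------------------------------------------------------------------
-- Modules over a commutative ring

IsZero : {R : CommutativeRing r ℓr} → Module R m ℓm → Set (m ⊔ ℓm)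
IsZero M = ∀ x → x ≈ᴹ 0ᴹ where open Module M

mkModule : (R : CommutativeRing r ℓr) (G : AbelianGroup m ℓm) →
  let open CommutativeRing R
      open AbelianGroup G renaming (Carrier to A; _≈_ to _≈ᴳ_; _∙_ to _+ᴳ_) using ()
  in
  (_·_ : Carrier → A → A) →
  (∀ {a b x y} → a ≈ b → x ≈ᴳ y → (a · x) ≈ᴳ (b · y)) →
  (∀ a x y → (a · (x +ᴳ y)) ≈ᴳ ((a · x) +ᴳ (a · y))) →
  (∀ a b x → ((a + b) · x) ≈ᴳ ((a · x) +ᴳ (b · x))) →
  (∀ a b x → ((a * b) · x) ≈ᴳ (a · (b · x))) →
  (∀ x → (1# · x) ≈ᴳ x) →
  Module R m ℓm
mkModule R G _·_ cong distribˡ distribʳ assoc identity = record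
  { isModule = IsModuleFromLeft.isModule {commutativeRing = R} record
    { isLeftModule = record
      { isLeftSemimodule = record
        { +ᴹ-isCommutativeMonoid = G.isCommutativeMonoid
        ; isPreleftSemimodule = record
          { *ₗ-cong      = cong
          ; *ₗ-zeroˡ     = λ x → identityˡ-unique (R.0# · x) (R.0# · x)
              (G.trans (G.sym (distribʳ R.0# R.0# x)) (cong (R.+-identityˡ R.0#) G.refl))
          ; *ₗ-distribʳ  = λ x a b → distribʳ a b x
          ; *ₗ-identityˡ = identity
          ; *ₗ-assoc     = assoc
          ; *ₗ-zeroʳ     = λ a → identityˡ-unique (a · G.ε) (a · G.ε)
              (G.trans (G.sym (distribˡ a G.ε G.ε)) (cong R.refl (G.identityˡ G.ε)))
          ; *ₗ-distribˡ  = distribˡ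
          }
        }
      ; -ᴹ‿cong    = G.⁻¹-cong
      ; -ᴹ‿inverse = G.inverse
      }
    }
  }
  where
  module R = CommutativeRing R
  module G = AbelianGroup G
  open AbelianGroupProperties G using (identityˡ-unique)

record Hom {R : CommutativeRing r ℓr} (M : Module R m₁ ℓm₁) (N : Module R m₂ ℓm₂)
       : Set (r ⊔ m₁ ⊔ ℓm₁ ⊔ m₂ ⊔ ℓm₂) where
  private
    module M = Module M
    module N = Module N
  open ModuleMorphisms M.rawModule N.rawModule using (IsModuleHomomorphism)
  field
    ⟦_⟧   : M.Carrierᴹ → N.Carrierᴹ
    isHom : IsModuleHomomorphism ⟦_⟧
  open IsModuleHomomorphism isHom public using (⟦⟧-cong; +ᴹ-homo; 0ᴹ-homo; -ᴹ-homo; *ₗ-homo; *ᵣ-homo)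

open Hom public using (⟦_⟧)

module _ {R : CommutativeRing r ℓr} {M : Module R m₁ ℓm₁} {N : Module R m₂ ℓm₂} where
  private
    module R = CommutativeRing R
    module M = Module M
    module N = Module N

  mkHom : (f : M.Carrierᴹ → N.Carrierᴹ) →
    (∀ {x y} → x M.≈ᴹ y → f x N.≈ᴹ f y) →
    (∀ x y → f (x M.+ᴹ y) N.≈ᴹ (f x N.+ᴹ f y)) →
    (∀ a x → f (a M.*ₗ x) N.≈ᴹ (a N.*ₗ f x)) →
    Hom M N
  mkHom f cong additive linear = record
    { ⟦_⟧   = f
    ; isHom = record
      { isBimoduleHomomorphism = record
        { +ᴹ-isGroupHomomorphism = record
          { isMonoidHomomorphism = record
            { isMagmaHomomorphism = record
              { isRelHomomorphism = record { cong = cong }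
              ; homo = additive
              }
            ; ε-homo = zero-homo
            }
          ; ⁻¹-homo = λ x → N.uniqueʳ‿-ᴹ (f x) (f (M.-ᴹ x))
              (N.≈ᴹ-trans (N.≈ᴹ-sym (additive x (M.-ᴹ x)))
                (N.≈ᴹ-trans (cong (M.-ᴹ‿inverseʳ x)) zero-homo))
          }
        ; *ₗ-homo = linear
        ; *ᵣ-homo = λ a x → N.≈ᴹ-trans (cong (M.≈ᴹ-sym (M.*ₗ-*ᵣ-coincident a x)))
            (N.≈ᴹ-trans (linear a x) (N.*ₗ-*ᵣ-coincident a (f x)))
        }
      }
    }
    where
    zero-homo : f M.0ᴹ N.≈ᴹ N.0ᴹ
    zero-homo = AbelianGroupProperties.identityˡ-unique N.+ᴹ-abelianGroup (f M.0ᴹ) (f M.0ᴹ)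
      (N.≈ᴹ-trans (N.≈ᴹ-sym (additive M.0ᴹ M.0ᴹ)) (cong (M.+ᴹ-identityˡ M.0ᴹ)))

-- The record wrapper (here and below) makes the two sides inferable from
-- the type of an equation.

record _≗ʰ_ {R : CommutativeRing r ℓr} {M : Module R m₁ ℓm₁} {N : Module R m₂ ℓm₂}
            (f g : Hom M N) : Set (m₁ ⊔ ℓm₂) where
  constructor pointwise
  field at : ∀ x → Module._≈ᴹ_ N (⟦ f ⟧ x) (⟦ g ⟧ x)

HomModule : {R : CommutativeRing r ℓr} → Module R m₁ ℓm₁ → Module R m₂ ℓm₂ →
            Module R (r ⊔ m₁ ⊔ ℓm₁ ⊔ m₂ ⊔ ℓm₂) (m₁ ⊔ ℓm₂)
HomModule {R = R} M N = mkModule R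
  record
    { Carrier = Hom M N
    ; _≈_ = _≗ʰ_
    ; _∙_ = _⊕_
    ; ε = mkHom (λ _ → N.0ᴹ) (λ _ → N.≈ᴹ-refl) (λ _ _ → N.≈ᴹ-sym (N.+ᴹ-identityˡ N.0ᴹ))
            (λ a _ → N.≈ᴹ-sym (N.*ₗ-zeroʳ a))
    ; _⁻¹ = λ f → mkHom (λ x → N.-ᴹ ⟦ f ⟧ x) (N.-ᴹ‿cong ∘ Hom.⟦⟧-cong f)
        (λ x y → N.≈ᴹ-trans (N.-ᴹ‿cong (Hom.+ᴹ-homo f x y)) (N.≈ᴹ-sym (⁻¹-∙-comm _ _)))
        (λ a x → N.≈ᴹ-trans (N.-ᴹ‿cong (Hom.*ₗ-homo f a x)) (N.≈ᴹ-sym (*-neg a _)))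
    ; isAbelianGroup = record
      { isGroup = record
        { isMonoid = record
          { isSemigroup = record
            { isMagma = record
              { isEquivalence = record
                { refl  = pointwise λ _ → N.≈ᴹ-refl
                ; sym   = λ (pointwise e) → pointwise λ x → N.≈ᴹ-sym (e x)
                ; trans = λ (pointwise e) (pointwise e′) → pointwise λ x → N.≈ᴹ-trans (e x) (e′ x)
                }
              ; ∙-cong = λ (pointwise e) (pointwise e′) → pointwise λ x → N.+ᴹ-cong (e x) (e′ x)
              }
            ; assoc = λ f g h → pointwise λ x → N.+ᴹ-assoc _ _ _
            }
          ; identity = (λ f → pointwise λ x → N.+ᴹ-identityˡ _) , (λ f → pointwise λ x → N.+ᴹ-identityʳ _)
          }
        ; inverse = (λ f → pointwise λ x → N.-ᴹ‿inverseˡ _) , (λ f → pointwise λ x → N.-ᴹ‿inverseʳ _)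
        ; ⁻¹-cong = λ (pointwise e) → pointwise λ x → N.-ᴹ‿cong (e x)
        }
      ; comm = λ f g → pointwise λ x → N.+ᴹ-comm _ _
      }
    }
  (λ a f → mkHom (λ x → a N.*ₗ ⟦ f ⟧ x) (N.*ₗ-congˡ ∘ Hom.⟦⟧-cong f)
    (λ x y → N.≈ᴹ-trans (N.*ₗ-congˡ (Hom.+ᴹ-homo f x y)) (N.*ₗ-distribˡ a _ _))
    (λ b x → N.≈ᴹ-trans (N.*ₗ-congˡ (Hom.*ₗ-homo f b x)) (*ₗ-comm a b _)))
  (λ a≈b (pointwise e) → pointwise λ x → N.*ₗ-cong a≈b (e x))
  (λ a f g → pointwise λ x → N.*ₗ-distribˡ a _ _)
  (λ a b f → pointwise λ x → N.*ₗ-distribʳ _ a b)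
  (λ a b f → pointwise λ x → N.*ₗ-assoc a b _)
  (λ f → pointwise λ x → N.*ₗ-identityˡ _)
  where
  module R = CommutativeRing R
  module M = Module M
  module N = Module N
  open AbelianGroupProperties N.+ᴹ-abelianGroup using (⁻¹-∙-comm)
  open CommutativeSemigroupProperties (AbelianGroup.commutativeSemigroup N.+ᴹ-abelianGroup) using (interchange)

  *ₗ-comm : ∀ a b x → (a N.*ₗ (b N.*ₗ x)) N.≈ᴹ (b N.*ₗ (a N.*ₗ x))
  *ₗ-comm a b x = N.≈ᴹ-trans (N.≈ᴹ-sym (N.*ₗ-assoc a b x))
    (N.≈ᴹ-trans (N.*ₗ-congʳ (R.*-comm a b)) (N.*ₗ-assoc b a x))

  *-neg : ∀ a x → (a N.*ₗ (N.-ᴹ x)) N.≈ᴹ (N.-ᴹ (a N.*ₗ x))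
  *-neg a x = N.uniqueʳ‿-ᴹ _ _ (N.≈ᴹ-trans (N.≈ᴹ-sym (N.*ₗ-distribˡ a x (N.-ᴹ x)))
    (N.≈ᴹ-trans (N.*ₗ-congˡ (N.-ᴹ‿inverseʳ x)) (N.*ₗ-zeroʳ a)))

  _⊕_ : Hom M N → Hom M N → Hom M N
  f ⊕ g = mkHom (λ x → ⟦ f ⟧ x N.+ᴹ ⟦ g ⟧ x)
    (λ e → N.+ᴹ-cong (Hom.⟦⟧-cong f e) (Hom.⟦⟧-cong g e))
    (λ x y → N.≈ᴹ-trans (N.+ᴹ-cong (Hom.+ᴹ-homo f x y) (Hom.+ᴹ-homo g x y)) (interchange _ _ _ _))
    (λ a x → N.≈ᴹ-trans (N.+ᴹ-cong (Hom.*ₗ-homo f a x) (Hom.*ₗ-homo g a x)) (N.≈ᴹ-sym (N.*ₗ-distribˡ a _ _)))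

------------------------------------------------------------------------
-- Submodules, quotients, cokernels

record Submodule {R : CommutativeRing r ℓr} (M : Module R m ℓm) p
       : Set (r ⊔ m ⊔ ℓm ⊔ lsuc p) where
  open CommutativeRing R using (Carrier)
  open Module M
  field
    Member  : Pred Carrierᴹ p
    resp    : ∀ {x y} → x ≈ᴹ y → Member x → Member y
    zero∈   : Member 0ᴹ
    +∈      : ∀ {x y} → Member x → Member y → Member (x +ᴹ y)
    *∈      : ∀ (a : Carrier) {x} → Member x → Member (a *ₗ x)

  -∈ : ∀ {x} → Member x → Member (-ᴹ x)
  -∈ {x} x∈ = resp (uniqueʳ‿-ᴹ x _ x+-1x≈0) (*∈ (R.- R.1#) x∈)
    where
    module R = CommutativeRing R
    x+-1x≈0 : (x +ᴹ ((R.- R.1#) *ₗ x)) ≈ᴹ 0ᴹ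
    x+-1x≈0 = ≈ᴹ-trans (+ᴹ-congʳ (≈ᴹ-sym (*ₗ-identityˡ x)))
      (≈ᴹ-trans (≈ᴹ-sym (*ₗ-distribʳ x R.1# (R.- R.1#)))
        (≈ᴹ-trans (*ₗ-congʳ (R.-‿inverseʳ R.1#)) (*ₗ-zeroˡ x)))

open Submodule public using (Member)

module _ {R : CommutativeRing r ℓr} (M : Module R m ℓm) where
  open CommutativeRing R using (Carrier)
  open Module M

  data Spanned (G : Pred Carrierᴹ p) : Pred Carrierᴹ (r ⊔ m ⊔ ℓm ⊔ p) where
    gen   : ∀ {x} → G x → Spanned G x
    zero∈ : Spanned G 0ᴹ
    +∈    : ∀ {x y} → Spanned G x → Spanned G y → Spanned G (x +ᴹ y)
    *∈    : ∀ (a : Carrier) {x} → Spanned G x → Spanned G (a *ₗ x)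
    resp  : ∀ {x y} → x ≈ᴹ y → Spanned G x → Spanned G y

  span : Pred Carrierᴹ p → Submodule M (r ⊔ m ⊔ ℓm ⊔ p)
  span G = record
    { Member = Spanned G ; resp = resp ; zero∈ = zero∈ ; +∈ = +∈ ; *∈ = *∈ }

  span-least : {G : Pred Carrierᴹ p} {q : Level} (N : Submodule M q) →
               (∀ {x} → G x → Member N x) → ∀ {x} → Spanned G x → Member N x
  span-least N G⊆N (gen g)    = G⊆N g
  span-least N G⊆N zero∈      = Submodule.zero∈ N
  span-least N G⊆N (+∈ s t)   = Submodule.+∈ N (span-least N G⊆N s) (span-least N G⊆N t)
  span-least N G⊆N (*∈ a s)   = Submodule.*∈ N a (span-least N G⊆N s)
  span-least N G⊆N (resp e s) = Submodule.resp N e (span-least N G⊆N s)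

module _ {R : CommutativeRing r ℓr} {M : Module R m₁ ℓm₁} {N : Module R m₂ ℓm₂} (f : Hom M N) where
  private
    module M = Module M
    module N = Module N

  ker : Submodule M ℓm₂
  ker = record
    { Member = λ x → ⟦ f ⟧ x N.≈ᴹ N.0ᴹ
    ; resp   = λ x≈y fx≈0 → N.≈ᴹ-trans (Hom.⟦⟧-cong f (M.≈ᴹ-sym x≈y)) fx≈0
    ; zero∈  = Hom.0ᴹ-homo f
    ; +∈     = λ fx≈0 fy≈0 → N.≈ᴹ-trans (Hom.+ᴹ-homo f _ _)
                 (N.≈ᴹ-trans (N.+ᴹ-cong fx≈0 fy≈0) (N.+ᴹ-identityˡ N.0ᴹ))
    ; *∈     = λ a fx≈0 → N.≈ᴹ-trans (Hom.*ₗ-homo f a _)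
                 (N.≈ᴹ-trans (N.*ₗ-congˡ fx≈0) (N.*ₗ-zeroʳ a))
    }

  im : Submodule N (m₁ ⊔ ℓm₂)
  im = record
    { Member = λ y → ∃[ x ] ⟦ f ⟧ x N.≈ᴹ y
    ; resp   = λ y≈z (x , e) → x , N.≈ᴹ-trans e y≈z
    ; zero∈  = M.0ᴹ , Hom.0ᴹ-homo f
    ; +∈     = λ (x , e) (x′ , e′) → (x M.+ᴹ x′) , N.≈ᴹ-trans (Hom.+ᴹ-homo f x x′) (N.+ᴹ-cong e e′)
    ; *∈     = λ a (x , e) → (a M.*ₗ x) , N.≈ᴹ-trans (Hom.*ₗ-homo f a x) (N.*ₗ-congˡ e)
    }

toModule : {R : CommutativeRing r ℓr} {M : Module R m ℓm} → Submodule M p → Module R (m ⊔ p) ℓm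
toModule {R = R} {M = M} N = mkModule R
  record
    { Carrier = Σ M.Carrierᴹ (Member N)
    ; _≈_ = λ x y → proj₁ x M.≈ᴹ proj₁ y
    ; _∙_ = λ (x , x∈) (y , y∈) → (x M.+ᴹ y) , N.+∈ x∈ y∈
    ; ε = M.0ᴹ , N.zero∈
    ; _⁻¹ = λ (x , x∈) → (M.-ᴹ x) , N.-∈ x∈
    ; isAbelianGroup = record
      { isGroup = record
        { isMonoid = record
          { isSemigroup = record
            { isMagma = record
              { isEquivalence = record { refl = M.≈ᴹ-refl ; sym = M.≈ᴹ-sym ; trans = M.≈ᴹ-trans }
              ; ∙-cong = M.+ᴹ-cong
              }
            ; assoc = λ _ _ _ → M.+ᴹ-assoc _ _ _
            }
          ; identity = (λ _ → M.+ᴹ-identityˡ _) , (λ _ → M.+ᴹ-identityʳ _)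
          }
        ; inverse = (λ _ → M.-ᴹ‿inverseˡ _) , (λ _ → M.-ᴹ‿inverseʳ _)
        ; ⁻¹-cong = M.-ᴹ‿cong
        }
      ; comm = λ _ _ → M.+ᴹ-comm _ _
      }
    }
  (λ a (x , x∈) → (a M.*ₗ x) , N.*∈ a x∈)
  M.*ₗ-cong
  (λ a _ _ → M.*ₗ-distribˡ a _ _)
  (λ a b _ → M.*ₗ-distribʳ _ a b)
  (λ a b _ → M.*ₗ-assoc a b _)
  (λ _ → M.*ₗ-identityˡ _)
  where
  module M = Module M
  module N = Submodule N

module Quotient {R : CommutativeRing r ℓr} {M : Module R m ℓm} (N : Submodule M p) where
  private
    module R = CommutativeRing R
    module M = Module M
    module N = Submodule N
    open SetoidReasoning M.≈ᴹ-setoid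
    open AbelianGroupProperties M.+ᴹ-abelianGroup using (⁻¹-∙-comm; ⁻¹-anti-homo‿-; ⁻¹-involutive)
    open CommutativeSemigroupProperties (AbelianGroup.commutativeSemigroup M.+ᴹ-abelianGroup)
      using (interchange)

  infix 4 _∼_

  record _∼_ (x y : M.Carrierᴹ) : Set p where
    constructor congruent
    field difference : Member N (x M.+ᴹ (M.-ᴹ y))

  ≈⇒∼ : ∀ {x y} → x M.≈ᴹ y → x ∼ y
  ≈⇒∼ {x} {y} x≈y = congruent $ N.resp
    (M.≈ᴹ-trans (M.≈ᴹ-sym (M.-ᴹ‿inverseʳ y)) (M.+ᴹ-congʳ (M.≈ᴹ-sym x≈y))) N.zero∈

  ∼-sym : ∀ {x y} → x ∼ y → y ∼ x
  ∼-sym {x} {y} (congruent e) = congruent $ N.resp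
    (begin
      M.-ᴹ (x M.+ᴹ (M.-ᴹ y))        ≈⟨ ⁻¹-∙-comm x (M.-ᴹ y) ⟨
      (M.-ᴹ x) M.+ᴹ (M.-ᴹ (M.-ᴹ y)) ≈⟨ M.+ᴹ-congˡ (⁻¹-involutive y) ⟩
      (M.-ᴹ x) M.+ᴹ y               ≈⟨ M.+ᴹ-comm _ _ ⟩
      y M.+ᴹ (M.-ᴹ x)               ∎)
    (N.-∈ e)

  ∼-trans : ∀ {x y z} → x ∼ y → y ∼ z → x ∼ z
  ∼-trans {x} {y} {z} (congruent e) (congruent e′) = congruent $ N.resp
    (begin
      (x M.+ᴹ (M.-ᴹ y)) M.+ᴹ (y M.+ᴹ (M.-ᴹ z)) ≈⟨ M.+ᴹ-assoc _ _ _ ⟩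
      x M.+ᴹ ((M.-ᴹ y) M.+ᴹ (y M.+ᴹ (M.-ᴹ z))) ≈⟨ M.+ᴹ-congˡ (M.+ᴹ-assoc _ _ _) ⟨
      x M.+ᴹ (((M.-ᴹ y) M.+ᴹ y) M.+ᴹ (M.-ᴹ z)) ≈⟨ M.+ᴹ-congˡ (M.+ᴹ-congʳ (M.-ᴹ‿inverseˡ y)) ⟩
      x M.+ᴹ (M.0ᴹ M.+ᴹ (M.-ᴹ z))              ≈⟨ M.+ᴹ-congˡ (M.+ᴹ-identityˡ _) ⟩
      x M.+ᴹ (M.-ᴹ z)                          ∎)
    (N.+∈ e e′)

  ∼-+-cong : ∀ {x y u v} → x ∼ y → u ∼ v → (x M.+ᴹ u) ∼ (y M.+ᴹ v)
  ∼-+-cong (congruent e) (congruent e′) = congruent $ N.resp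
    (M.≈ᴹ-trans (interchange _ _ _ _) (M.+ᴹ-congˡ (⁻¹-∙-comm _ _))) (N.+∈ e e′)

  ∼-neg-cong : ∀ {x y} → x ∼ y → (M.-ᴹ x) ∼ (M.-ᴹ y)
  ∼-neg-cong (congruent e) = congruent $ N.resp (M.≈ᴹ-sym (⁻¹-∙-comm _ _)) (N.-∈ e)

  *-neg : ∀ a x → (a M.*ₗ (M.-ᴹ x)) M.≈ᴹ (M.-ᴹ (a M.*ₗ x))
  *-neg a x = M.uniqueʳ‿-ᴹ _ _ (M.≈ᴹ-trans (M.≈ᴹ-sym (M.*ₗ-distribˡ a x (M.-ᴹ x)))
    (M.≈ᴹ-trans (M.*ₗ-congˡ (M.-ᴹ‿inverseʳ x)) (M.*ₗ-zeroʳ a)))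

  ∼-*ₗ-cong : ∀ a {x y} → x ∼ y → (a M.*ₗ x) ∼ (a M.*ₗ y)
  ∼-*ₗ-cong a (congruent e) = congruent $ N.resp
    (M.≈ᴹ-trans (M.*ₗ-distribˡ a _ _) (M.+ᴹ-congˡ (*-neg a _))) (N.*∈ a e)

  ∼0⁺ : ∀ {x} → Member N x → x ∼ M.0ᴹ
  ∼0⁺ {x} x∈ = congruent $ N.resp
    (begin
      x                   ≈⟨ M.+ᴹ-identityʳ x ⟨
      x M.+ᴹ M.0ᴹ         ≈⟨ M.+ᴹ-congˡ (M.-ᴹ‿inverseʳ M.0ᴹ) ⟨
      x M.+ᴹ (M.0ᴹ M.+ᴹ (M.-ᴹ M.0ᴹ)) ≈⟨ M.+ᴹ-congˡ (M.+ᴹ-identityˡ _) ⟩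
      x M.+ᴹ (M.-ᴹ M.0ᴹ)  ∎)
    x∈

  quotientGroup : AbelianGroup m p
  quotientGroup = record
    { Carrier = M.Carrierᴹ
    ; _≈_ = _∼_
    ; _∙_ = M._+ᴹ_
    ; ε = M.0ᴹ
    ; _⁻¹ = M.-ᴹ_
    ; isAbelianGroup = record
      { isGroup = record
        { isMonoid = record
          { isSemigroup = record
            { isMagma = record
              { isEquivalence = record { refl = ≈⇒∼ M.≈ᴹ-refl ; sym = ∼-sym ; trans = ∼-trans }
              ; ∙-cong = ∼-+-cong
              }
            ; assoc = λ x y z → ≈⇒∼ (M.+ᴹ-assoc x y z)
            }
          ; identity = (λ x → ≈⇒∼ (M.+ᴹ-identityˡ x)) , (λ x → ≈⇒∼ (M.+ᴹ-identityʳ x))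
          }
        ; inverse = (λ x → ≈⇒∼ (M.-ᴹ‿inverseˡ x)) , (λ x → ≈⇒∼ (M.-ᴹ‿inverseʳ x))
        ; ⁻¹-cong = ∼-neg-cong
        }
      ; comm = λ x y → ≈⇒∼ (M.+ᴹ-comm x y)
      }
    }

  quotient : Module R m p
  quotient = mkModule R quotientGroup M._*ₗ_
    (λ {a} a≈b x∼y → ∼-trans (∼-*ₗ-cong a x∼y) (≈⇒∼ (M.*ₗ-congʳ a≈b)))
    (λ a x y → ≈⇒∼ (M.*ₗ-distribˡ a x y))
    (λ a b x → ≈⇒∼ (M.*ₗ-distribʳ x a b))
    (λ a b x → ≈⇒∼ (M.*ₗ-assoc a b x))
    (λ x → ≈⇒∼ (M.*ₗ-identityˡ x))

open Quotient public using (quotient)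

coker : {R : CommutativeRing r ℓr} {M : Module R m₁ ℓm₁} {N : Module R m₂ ℓm₂} →
        Hom M N → Module R m₂ (m₁ ⊔ ℓm₂)
coker f = quotient (im f)

------------------------------------------------------------------------
-- Ideals, quotient rings and free modules

Ideal : CommutativeRing r ℓr → ∀ p → Set (r ⊔ ℓr ⊔ lsuc p)
Ideal R p = Submodule (⟨module⟩ {R = R}) p

module _ {S : CommutativeRing r ℓr} (I : Ideal S p) where
  private
    module S = CommutativeRing S
    module I = Submodule I
    open Quotient I

  quotientRing : CommutativeRing r p
  quotientRing = record
    { Carrier = S.Carrier
    ; _≈_ = _∼_
    ; _+_ = S._+_
    ; _*_ = S._*_
    ; -_ = S.-_
    ; 0# = S.0#
    ; 1# = S.1#
    ; isCommutativeRing = record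
      { isRing = record
        { +-isAbelianGroup = AbelianGroup.isAbelianGroup quotientGroup
        ; *-cong = λ {x} {y} {u} {v} x∼y u∼v → ∼-trans (∼-*ₗ-cong x u∼v)
            (∼-trans (≈⇒∼ (S.*-comm x v)) (∼-trans (∼-*ₗ-cong v x∼y) (≈⇒∼ (S.*-comm v y))))
        ; *-assoc = λ x y z → ≈⇒∼ (S.*-assoc x y z)
        ; *-identity = (λ x → ≈⇒∼ (S.*-identityˡ x)) , (λ x → ≈⇒∼ (S.*-identityʳ x))
        ; distrib = (λ x y z → ≈⇒∼ (S.distribˡ x y z)) , (λ x y z → ≈⇒∼ (S.distribʳ x y z))
        }
      ; *-comm = λ x y → ≈⇒∼ (S.*-comm x y)
      }
    }

  -- An S-module annihilated by I, regarded as an S/I-module.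
  overQuotient : (M : Module S m ℓm) → let open Module M in
    (∀ {a} → Member I a → ∀ x → (a *ₗ x) ≈ᴹ 0ᴹ) → Module quotientRing m ℓm
  overQuotient M annihilated = mkModule quotientRing M.+ᴹ-abelianGroup M._*ₗ_
    (λ {a} {b} {x} (congruent e) x≈y → M.≈ᴹ-trans
      (x∙y⁻¹≈ε⇒x≈y _ _ (M.≈ᴹ-trans (M.≈ᴹ-sym (diff a b x)) (annihilated e x)))
      (M.*ₗ-congˡ x≈y))
    M.*ₗ-distribˡ (λ a b x → M.*ₗ-distribʳ x a b) M.*ₗ-assoc M.*ₗ-identityˡ
    where
    module M = Module M
    open AbelianGroupProperties M.+ᴹ-abelianGroup using (x∙y⁻¹≈ε⇒x≈y)
    diff : ∀ a b x → ((a S.+ (S.- b)) M.*ₗ x) M.≈ᴹ ((a M.*ₗ x) M.+ᴹ (M.-ᴹ (b M.*ₗ x)))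
    diff a b x = M.≈ᴹ-trans (M.*ₗ-distribʳ x a (S.- b)) (M.+ᴹ-congˡ
      (M.uniqueʳ‿-ᴹ _ _ (M.≈ᴹ-trans (M.≈ᴹ-sym (M.*ₗ-distribʳ x b (S.- b)))
        (M.≈ᴹ-trans (M.*ₗ-congʳ (S.-‿inverseʳ b)) (M.*ₗ-zeroˡ x)))))

Free : (R : CommutativeRing r ℓr) → ℕ → Module R r ℓr
Free R k = mkModule R
  record
    { Carrier = Vector R.Carrier k
    ; _≈_ = λ f g → ∀ i → f i R.≈ g i
    ; _∙_ = λ f g i → f i R.+ g i
    ; ε = λ _ → R.0#
    ; _⁻¹ = λ f i → R.- f i
    ; isAbelianGroup = record
      { isGroup = record
        { isMonoid = record
          { isSemigroup = record
            { isMagma = record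
              { isEquivalence = record
                { refl = λ _ → R.refl ; sym = λ e i → R.sym (e i) ; trans = λ e e′ i → R.trans (e i) (e′ i) }
              ; ∙-cong = λ e e′ i → R.+-cong (e i) (e′ i)
              }
            ; assoc = λ _ _ _ _ → R.+-assoc _ _ _
            }
          ; identity = (λ _ _ → R.+-identityˡ _) , (λ _ _ → R.+-identityʳ _)
          }
        ; inverse = (λ _ _ → R.-‿inverseˡ _) , (λ _ _ → R.-‿inverseʳ _)
        ; ⁻¹-cong = λ e i → R.-‿cong (e i)
        }
      ; comm = λ _ _ _ → R.+-comm _ _
      }
    }
  (λ a f i → a R.* f i)
  (λ a≈b e i → R.*-cong a≈b (e i))
  (λ a _ _ _ → R.distribˡ a _ _)
  (λ a b _ _ → R.distribʳ _ a b)
  (λ a b _ _ → R.*-assoc a b _)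
  (λ _ _ → R.*-identityˡ _)
  where module R = CommutativeRing R

linearCombination : {R : CommutativeRing r ℓr} {k : ℕ} →
  Vector (CommutativeRing.Carrier R) k → Hom (Free R k) (⟨module⟩ {R = R})
linearCombination {R = R} g = mkHom
  (λ f → sum (λ i → f i * g i))
  (λ e → sum-cong-≋ λ i → *-congʳ (e i))
  (λ f f′ → trans (sum-cong-≋ λ i → distribʳ (g i) (f i) (f′ i)) (∑-distrib-+ (λ i → f i * g i) (λ i → f′ i * g i)))
  (λ a f → trans (sum-cong-≋ λ i → *-assoc a (f i) (g i)) (sym (*-distribˡ-sum a (λ i → f i * g i))))
  where
  open CommutativeRing R
  open SemiringSum semiring using (sum; sum-cong-≋; ∑-distrib-+; *-distribˡ-sum)

------------------------------------------------------------------------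
-- The second cotangent cohomology module of S / I, where I is the ideal
-- generated by the family g (the finite generation of I by g makes Syz/Kosz
-- an S/I-module)

module SecondCotangentCohomology
  {r ℓr p : Level} (S : CommutativeRing r ℓr) (I : Ideal S p) {k : ℕ}
  (g : Vector (CommutativeRing.Carrier S) k)
  (g∈I : ∀ i → Member I (g i))
  (I⊆⟨g⟩ : ∀ {a} → Member I a → Member (im (linearCombination {R = S} g)) a)
  where

  private
    module S = CommutativeRing S
    module I = Submodule I
    module Sᵏ = Module (Free S k)

  d : Hom (Free S k) (⟨module⟩ {R = S})
  d = linearCombination {R = S} g

  Syz : Submodule (Free S k) ℓr
  Syz = ker d

  -- d(f) f′ - d(f′) f
  koszul : (f f′ : Sᵏ.Carrierᴹ) → Module.Carrierᴹ (toModule Syz)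
  koszul f f′ = h , d[h]≈0
    where
    h : Sᵏ.Carrierᴹ
    h = (⟦ d ⟧ f Sᵏ.*ₗ f′) Sᵏ.+ᴹ (Sᵏ.-ᴹ (⟦ d ⟧ f′ Sᵏ.*ₗ f))

    d[h]≈0 : ⟦ d ⟧ h S.≈ S.0#
    d[h]≈0 = begin
      ⟦ d ⟧ h
        ≈⟨ Hom.+ᴹ-homo d (⟦ d ⟧ f Sᵏ.*ₗ f′) (Sᵏ.-ᴹ (⟦ d ⟧ f′ Sᵏ.*ₗ f)) ⟩
      ⟦ d ⟧ (⟦ d ⟧ f Sᵏ.*ₗ f′) S.+ ⟦ d ⟧ (Sᵏ.-ᴹ (⟦ d ⟧ f′ Sᵏ.*ₗ f))
        ≈⟨ S.+-cong (Hom.*ₗ-homo d (⟦ d ⟧ f) f′)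
             (S.trans (Hom.-ᴹ-homo d (⟦ d ⟧ f′ Sᵏ.*ₗ f)) (S.-‿cong (Hom.*ₗ-homo d (⟦ d ⟧ f′) f))) ⟩
      (⟦ d ⟧ f S.* ⟦ d ⟧ f′) S.+ (S.- (⟦ d ⟧ f′ S.* ⟦ d ⟧ f))
        ≈⟨ S.+-congˡ (S.-‿cong (S.*-comm (⟦ d ⟧ f′) (⟦ d ⟧ f))) ⟩
      (⟦ d ⟧ f S.* ⟦ d ⟧ f′) S.+ (S.- (⟦ d ⟧ f S.* ⟦ d ⟧ f′))
        ≈⟨ S.-‿inverseʳ _ ⟩
      S.0# ∎
      where open SetoidReasoning S.setoid

  -- A submodule of Syz, so the quotient below is Syz(I)/Kosz(I).
  Kosz : Submodule (toModule Syz) (r ⊔ ℓr)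
  Kosz = span (toModule Syz) λ z → ∃[ f ] ∃[ f′ ] z ≡ koszul f f′

  -- S/I, as a module over S and over itself
  S/Iˢ : Module S r p
  S/Iˢ = quotient I

  S/I : Module (quotientRing I) r p
  S/I = ⟨module⟩ {R = quotientRing I}

  Syz/Kosz : Module (quotientRing I) (r ⊔ ℓr) (r ⊔ ℓr)
  Syz/Kosz = overQuotient I (quotient Kosz) λ {a} a∈I z → Quotient.∼0⁺ Kosz (annihilated a∈I z)
    where
    module Q = Module (toModule Syz)
    annihilated : ∀ {a} → Member I a → ∀ z → Member Kosz (a Q.*ₗ z)
    annihilated {a} a∈I z@(h , d[h]≈0) with f , d[f]≈a ← I⊆⟨g⟩ a∈I =
      resp (λ i → begin
        (⟦ d ⟧ f S.* h i) S.+ (S.- (⟦ d ⟧ h S.* f i))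
          ≈⟨ S.+-cong (S.*-congʳ d[f]≈a) (S.-‿cong (S.trans (S.*-congʳ d[h]≈0) (S.zeroˡ (f i)))) ⟩
        (a S.* h i) S.+ (S.- S.0#)
          ≈⟨ S.+-congˡ -0#≈0# ⟩
        (a S.* h i) S.+ S.0#
          ≈⟨ S.+-identityʳ _ ⟩
        a S.* h i ∎)
      (gen (f , h , ≡.refl))
      where
      open SetoidReasoning S.setoid
      open RingProperties S.ring using (-0#≈0#)

  restrict : Hom (Free S k) S/Iˢ → Hom Syz/Kosz S/I
  restrict φ = mkHom (λ (h , _) → ⟦ φ ⟧ h)
    (λ {(h , _)} {(h′ , _)} (Quotient.congruent h-h′∈Kosz) →
      φ-cong h h′ (span-least (toModule Syz) (ker φ∣Syz) φ[koszul]≈0 h-h′∈Kosz))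
    (λ (h , _) (h′ , _) → Hom.+ᴹ-homo φ h h′)
    (λ a (h , _) → Hom.*ₗ-homo φ a h)
    where
    module Q = Module S/Iˢ
    open AbelianGroupProperties Q.+ᴹ-abelianGroup using (x∙y⁻¹≈ε⇒x≈y)

    φ∣Syz : Hom (toModule Syz) S/Iˢ
    φ∣Syz = mkHom (λ (h , _) → ⟦ φ ⟧ h) (Hom.⟦⟧-cong φ)
      (λ (h , _) (h′ , _) → Hom.+ᴹ-homo φ h h′) (λ a (h , _) → Hom.*ₗ-homo φ a h)

    φ-cong : ∀ h h′ → ⟦ φ ⟧ (h Sᵏ.+ᴹ (Sᵏ.-ᴹ h′)) Q.≈ᴹ Q.0ᴹ → ⟦ φ ⟧ h Q.≈ᴹ ⟦ φ ⟧ h′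
    φ-cong h h′ e = x∙y⁻¹≈ε⇒x≈y _ _ (Q.≈ᴹ-trans (Q.≈ᴹ-sym
      (Q.≈ᴹ-trans (Hom.+ᴹ-homo φ h (Sᵏ.-ᴹ h′)) (Q.+ᴹ-congˡ (Hom.-ᴹ-homo φ h′)))) e)

    *-zero : ∀ {a} → Member I a → ∀ x → (a Q.*ₗ x) Q.≈ᴹ Q.0ᴹ
    *-zero {a} a∈I x = Quotient.∼0⁺ I (I.resp (S.*-comm x a) (I.*∈ x a∈I))

    d[f]∈I : ∀ f → Member I (⟦ d ⟧ f)
    d[f]∈I f = sum∈I (λ i → I.*∈ (f i) (g∈I i))
      where
      open SemiringSum S.semiring using (sum)
      sum∈I : ∀ {j} {t : Vector S.Carrier j} → (∀ i → Member I (t i)) → Member I (sum t)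
      sum∈I {zero}  t∈I = I.zero∈
      sum∈I {suc j} t∈I = I.+∈ (t∈I Fin.zero) (sum∈I (t∈I ∘ Fin.suc))

    φ[koszul]≈0 : ∀ {z} → ∃[ f ] ∃[ f′ ] z ≡ koszul f f′ → Member (ker φ∣Syz) z
    φ[koszul]≈0 (f , f′ , ≡.refl) = Q.≈ᴹ-trans
      (Hom.+ᴹ-homo φ (⟦ d ⟧ f Sᵏ.*ₗ f′) (Sᵏ.-ᴹ (⟦ d ⟧ f′ Sᵏ.*ₗ f)))
      (Q.≈ᴹ-trans
        (Q.+ᴹ-cong
          (Q.≈ᴹ-trans (Hom.*ₗ-homo φ (⟦ d ⟧ f) f′) (*-zero (d[f]∈I f) _))
          (Q.≈ᴹ-trans (Hom.-ᴹ-homo φ (⟦ d ⟧ f′ Sᵏ.*ₗ f))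
            (Q.-ᴹ‿cong (Q.≈ᴹ-trans (Hom.*ₗ-homo φ (⟦ d ⟧ f′) f) (*-zero (d[f]∈I f′) _)))))
        (Q.-ᴹ‿inverseʳ Q.0ᴹ))

  homAnnihilated : let open Module (HomModule (Free S k) S/Iˢ) in
    ∀ {a} → Member I a → ∀ φ → (a *ₗ φ) ≈ᴹ 0ᴹ
  homAnnihilated {a} a∈I φ = pointwise λ x →
    Quotient.∼0⁺ I (I.resp (S.*-comm (⟦ φ ⟧ x) a) (I.*∈ (⟦ φ ⟧ x) a∈I))

  restriction : Hom (overQuotient I (HomModule (Free S k) S/Iˢ) homAnnihilated) (HomModule Syz/Kosz S/I)
  restriction = mkHom restrict
    (λ (pointwise e) → pointwise λ (h , _) → e h)
    (λ _ _ → pointwise λ _ → Quotient.≈⇒∼ I S.refl)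
    (λ _ _ → pointwise λ _ → Quotient.≈⇒∼ I S.refl)

  T² : Module (quotientRing I) (r ⊔ ℓr ⊔ p) (r ⊔ ℓr ⊔ p)
  T² = coker restriction

------------------------------------------------------------------------
-- The polynomial ring R[x₁,…,xₙ]

-- A polynomial is a formal sum of terms c·xᵃ, with a ∈ ℕⁿ; terms with the
-- same exponent may be repeated, and two formal sums are equal when all
-- their coefficients agree.

module Polynomial (R : CommutativeRing r ℓr) (n : ℕ) where

  private
    module R = CommutativeRing R
    open R using (0#; 1#; _+_; _*_; -_; _≈_)
    open SetoidReasoning R.setoid
    open CommutativeSemigroupProperties R.+-commutativeSemigroup using (interchange)
    open CommutativeSemigroupProperties R.*-commutativeSemigroup using (x∙yz≈y∙xz)
    open RingProperties R.ring using (-‿distribˡ-*; -‿+-comm; -0#≈0#; x∙y⁻¹≈ε⇒x≈y)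

  Exponent : Set
  Exponent = Vec ℕ n

  _⊕_ : Exponent → Exponent → Exponent
  _⊕_ = Vec.zipWith ℕ._+_

  𝟘 : Exponent
  𝟘 = Vec.replicate n 0

  _≟_ : (a b : Exponent) → Dec (a ≡ b)
  _≟_ = ≡-dec ℕₚ._≟_

  Poly : Set r
  Poly = List (R.Carrier × Exponent)

  coeff : Poly → Exponent → R.Carrier
  coeff []            e = 0#
  coeff ((c , a) ∷ P) e = (if does (a ≟ e) then c else 0#) + coeff P e

  infix 4 _≈ᴾ_

  record _≈ᴾ_ (P Q : Poly) : Set ℓr where
    constructor coefficientwise
    field at : ∀ e → coeff P e ≈ coeff Q e

  monomial : Exponent → Poly
  monomial a = (1# , a) ∷ []

  _+ᴾ_ : Poly → Poly → Poly
  _+ᴾ_ = _++_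

  -ᴾ_ : Poly → Poly
  -ᴾ_ = List.map λ (c , a) → (- c) , a

  scale : R.Carrier × Exponent → Poly → Poly
  scale (c , a) = List.map λ (c′ , a′) → (c * c′) , (a ⊕ a′)

  _*ᴾ_ : Poly → Poly → Poly
  []      *ᴾ Q = []
  (t ∷ P) *ᴾ Q = scale t Q +ᴾ (P *ᴾ Q)

  -- The ring laws are checked on the R-linear functionals xᵃ ↦ w a, which
  -- separate polynomials and are well defined on them.

  pair : (Exponent → R.Carrier) → Poly → R.Carrier
  pair w []            = 0#
  pair w ((c , a) ∷ P) = c * w a + pair w P

  δ : Exponent → Exponent → R.Carrier
  δ e a = if does (a ≟ e) then 1# else 0#

  coeff≈pair : ∀ P e → coeff P e ≈ pair (δ e) P
  coeff≈pair []            e = R.refl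
  coeff≈pair ((c , a) ∷ P) e with does (a ≟ e)
  ... | true  = R.+-cong (R.sym (R.*-identityʳ c)) (coeff≈pair P e)
  ... | false = R.+-cong (R.sym (R.zeroʳ c)) (coeff≈pair P e)

  pair⇒≈ : ∀ {P Q} → (∀ w → pair w P ≈ pair w Q) → P ≈ᴾ Q
  pair⇒≈ {P} {Q} h = coefficientwise λ e →
    R.trans (coeff≈pair P e) (R.trans (h (δ e)) (R.sym (coeff≈pair Q e)))

  pair-cong : ∀ {w w′} P → (∀ a → w a ≈ w′ a) → pair w P ≈ pair w′ P
  pair-cong []            h = R.refl
  pair-cong ((c , a) ∷ P) h = R.+-cong (R.*-congˡ (h a)) (pair-cong P h)

  pair-++ : ∀ w P Q → pair w (P ++ Q) ≈ pair w P + pair w Q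
  pair-++ w []            Q = R.sym (R.+-identityˡ _)
  pair-++ w ((c , a) ∷ P) Q = R.trans (R.+-congˡ (pair-++ w P Q)) (R.sym (R.+-assoc _ _ _))

  pair-neg : ∀ w P → pair w (-ᴾ P) ≈ - pair w P
  pair-neg w []            = R.sym -0#≈0#
  pair-neg w ((c , a) ∷ P) =
    R.trans (R.+-cong (R.sym (-‿distribˡ-* c (w a))) (pair-neg w P)) (-‿+-comm _ _)

  pair-zero : ∀ P → pair (λ _ → 0#) P ≈ 0#
  pair-zero []            = R.refl
  pair-zero ((c , a) ∷ P) = R.trans (R.+-cong (R.zeroʳ c) (pair-zero P)) (R.+-identityˡ 0#)

  pair-+ : ∀ w w′ P → pair (λ a → w a + w′ a) P ≈ pair w P + pair w′ P
  pair-+ w w′ []            = R.sym (R.+-identityˡ 0#)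
  pair-+ w w′ ((c , a) ∷ P) =
    R.trans (R.+-cong (R.distribˡ c (w a) (w′ a)) (pair-+ w w′ P)) (interchange _ _ _ _)

  pair-* : ∀ k w P → pair (λ a → k * w a) P ≈ k * pair w P
  pair-* k w []            = R.sym (R.zeroʳ k)
  pair-* k w ((c , a) ∷ P) =
    R.trans (R.+-cong (x∙yz≈y∙xz c k (w a)) (pair-* k w P)) (R.sym (R.distribˡ k _ _))

  pair-swap : ∀ (w : Exponent → Exponent → R.Carrier) P Q →
    pair (λ a → pair (w a) Q) P ≈ pair (λ b → pair (λ a → w a b) P) Q
  pair-swap w []            Q = R.sym (pair-zero Q)
  pair-swap w ((c , a) ∷ P) Q = begin
    c * pair (w a) Q + pair (λ a′ → pair (w a′) Q) P
      ≈⟨ R.+-cong (R.sym (pair-* c (w a) Q)) (pair-swap w P Q) ⟩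
    pair (λ b → c * w a b) Q + pair (λ b → pair (λ a′ → w a′ b) P) Q
      ≈⟨ pair-+ _ _ Q ⟨
    pair (λ b → c * w a b + pair (λ a′ → w a′ b) P) Q ∎

  pair-scale : ∀ w c a Q → pair w (scale (c , a) Q) ≈ c * pair (λ b → w (a ⊕ b)) Q
  pair-scale w c a []             = R.sym (R.zeroʳ c)
  pair-scale w c a ((c′ , b) ∷ Q) =
    R.trans (R.+-cong (R.*-assoc c c′ _) (pair-scale w c a Q)) (R.sym (R.distribˡ c _ _))

  pair-*ᴾ : ∀ w P Q → pair w (P *ᴾ Q) ≈ pair (λ a → pair (λ b → w (a ⊕ b)) Q) P
  pair-*ᴾ w []            Q = R.refl
  pair-*ᴾ w ((c , a) ∷ P) Q =
    R.trans (pair-++ w (scale (c , a) Q) (P *ᴾ Q)) (R.+-cong (pair-scale w c a Q) (pair-*ᴾ w P Q))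

  drop : Exponent → Poly → Poly
  drop a = List.filter λ (_ , b) → ¬? (b ≟ a)

  pair-drop : ∀ w a P → pair w P ≈ coeff P a * w a + pair w (drop a P)
  pair-drop w a []            = R.sym (R.trans (R.+-identityʳ _) (R.zeroˡ (w a)))
  pair-drop w a ((c , b) ∷ P) with b ≟ a
  ... | yes ≡.refl = R.trans (R.+-congˡ (pair-drop w a P))
        (R.trans (R.sym (R.+-assoc _ _ _)) (R.+-congʳ (R.sym (R.distribʳ (w a) c (coeff P a)))))
  ... | no _ = begin
    c * w b + pair w P
      ≈⟨ R.+-congˡ (pair-drop w a P) ⟩
    c * w b + (coeff P a * w a + pair w (drop a P))
      ≈⟨ R.+-assoc _ _ _ ⟨
    (c * w b + coeff P a * w a) + pair w (drop a P)
      ≈⟨ R.+-congʳ (R.+-comm _ _) ⟩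
    (coeff P a * w a + c * w b) + pair w (drop a P)
      ≈⟨ R.+-assoc _ _ _ ⟩
    coeff P a * w a + (c * w b + pair w (drop a P))
      ≈⟨ R.+-congʳ (R.*-congʳ (R.+-identityˡ _)) ⟨
    (0# + coeff P a) * w a + (c * w b + pair w (drop a P)) ∎

  coeff-drop : ∀ a P e → (a ≡ e × coeff (drop a P) e ≈ 0#) ⊎ (coeff (drop a P) e ≈ coeff P e)
  coeff-drop a P e with a ≟ e
  ... | yes ≡.refl = inj₁ (≡.refl , same P)
    where
    same : ∀ P → coeff (drop a P) a ≈ 0#
    same []            = R.refl
    same ((c , b) ∷ P) with b ≟ a
    ... | yes _  = same P
    ... | no b≢a with b ≟ a
    ...   | yes b≡a = ⊥-elim (b≢a b≡a)
    ...   | no _    = R.trans (R.+-identityˡ _) (same P)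
  ... | no a≢e = inj₂ (other P)
    where
    other : ∀ P → coeff (drop a P) e ≈ coeff P e
    other []            = R.refl
    other ((c , b) ∷ P) with b ≟ a
    ... | no _       = R.+-congˡ (other P)
    ... | yes ≡.refl with b ≟ e
    ...   | yes b≡e = ⊥-elim (a≢e b≡e)
    ...   | no _    = R.trans (other P) (R.sym (R.+-identityˡ _))

  length-drop : ∀ a P → length (drop a P) ≤ length P
  length-drop a P = length-filter (λ (_ , b) → ¬? (b ≟ a)) P

  drop-head : ∀ c a P → drop a ((c , a) ∷ P) ≡ drop a P
  drop-head c a P with a ≟ a
  ... | yes _  = ≡.refl
  ... | no a≢a = ⊥-elim (a≢a ≡.refl)

  pair-null : ∀ w k P → length P ≤ k → (∀ e → coeff P e ≈ 0#) → pair w P ≈ 0#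
  pair-null w k       []                 _         null = R.refl
  pair-null w (suc k) P′@((c , a) ∷ P) (s≤s ∣P∣≤k) null = begin
    pair w P′
      ≈⟨ pair-drop w a P′ ⟩
    coeff P′ a * w a + pair w (drop a P′)
      ≈⟨ R.+-cong (R.trans (R.*-congʳ (null a)) (R.zeroˡ (w a))) (R.reflexive (≡.cong (pair w) (drop-head c a P))) ⟩
    0# + pair w (drop a P)
      ≈⟨ R.+-identityˡ _ ⟩
    pair w (drop a P)
      ≈⟨ pair-null w k (drop a P) (ℕₚ.≤-trans (length-drop a P) ∣P∣≤k) null′ ⟩
    0# ∎
    where
    null′ : ∀ e → coeff (drop a P) e ≈ 0#
    null′ e with coeff-drop a P′ e
    ... | inj₁ (_ , z) = ≡.subst (λ Q → coeff Q e ≈ 0#) (drop-head c a P) z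
    ... | inj₂ z       = R.trans (≡.subst (λ Q → coeff Q e ≈ coeff P′ e) (drop-head c a P) z) (null e)

  ≈⇒pair : ∀ {P Q} → P ≈ᴾ Q → ∀ w → pair w P ≈ pair w Q
  ≈⇒pair {P} {Q} (coefficientwise P≈Q) w = x∙y⁻¹≈ε⇒x≈y _ _
    (R.trans (R.sym (expand w)) (pair-null w _ (P ++ (-ᴾ Q)) ℕₚ.≤-refl λ e → begin
      coeff (P ++ (-ᴾ Q)) e          ≈⟨ coeff≈pair (P ++ (-ᴾ Q)) e ⟩
      pair (δ e) (P ++ (-ᴾ Q))       ≈⟨ expand (δ e) ⟩
      pair (δ e) P + - pair (δ e) Q  ≈⟨ R.+-cong (R.sym (coeff≈pair P e)) (R.-‿cong (R.sym (coeff≈pair Q e))) ⟩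
      coeff P e + - coeff Q e        ≈⟨ R.+-congʳ (P≈Q e) ⟩
      coeff Q e + - coeff Q e        ≈⟨ R.-‿inverseʳ _ ⟩
      0#                             ∎))
    where
    expand : ∀ w → pair w (P ++ (-ᴾ Q)) ≈ pair w P + - pair w Q
    expand w = R.trans (pair-++ w P (-ᴾ Q)) (R.+-congˡ (pair-neg w Q))

  ⊕-assoc : ∀ a b c → (a ⊕ b) ⊕ c ≡ a ⊕ (b ⊕ c)
  ⊕-assoc = zipWith-assoc ℕₚ.+-assoc

  ⊕-comm : ∀ a b → a ⊕ b ≡ b ⊕ a
  ⊕-comm = zipWith-comm ℕₚ.+-comm

  ⊕-identityˡ : ∀ a → 𝟘 ⊕ a ≡ a
  ⊕-identityˡ = zipWith-identityˡ ℕₚ.+-identityˡ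

  +ᴾ-comm : ∀ P Q → P +ᴾ Q ≈ᴾ Q +ᴾ P
  +ᴾ-comm P Q = pair⇒≈ λ w →
    R.trans (pair-++ w P Q) (R.trans (R.+-comm _ _) (R.sym (pair-++ w Q P)))

  -ᴾ-inverseʳ : ∀ P → P +ᴾ (-ᴾ P) ≈ᴾ []
  -ᴾ-inverseʳ P = pair⇒≈ λ w →
    R.trans (pair-++ w P (-ᴾ P)) (R.trans (R.+-congˡ (pair-neg w P)) (R.-‿inverseʳ _))

  *ᴾ-comm : ∀ P Q → P *ᴾ Q ≈ᴾ Q *ᴾ P
  *ᴾ-comm P Q = pair⇒≈ λ w → begin
    pair w (P *ᴾ Q)                             ≈⟨ pair-*ᴾ w P Q ⟩
    pair (λ a → pair (λ b → w (a ⊕ b)) Q) P     ≈⟨ pair-swap _ P Q ⟩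
    pair (λ b → pair (λ a → w (a ⊕ b)) P) Q
      ≈⟨ pair-cong Q (λ b → pair-cong P λ a → R.reflexive (≡.cong w (⊕-comm a b))) ⟩
    pair (λ b → pair (λ a → w (b ⊕ a)) P) Q     ≈⟨ pair-*ᴾ w Q P ⟨
    pair w (Q *ᴾ P)                             ∎

  *ᴾ-assoc : ∀ P Q T → (P *ᴾ Q) *ᴾ T ≈ᴾ P *ᴾ (Q *ᴾ T)
  *ᴾ-assoc P Q T = pair⇒≈ λ w → begin
    pair w ((P *ᴾ Q) *ᴾ T)
      ≈⟨ pair-*ᴾ w (P *ᴾ Q) T ⟩
    pair (λ e → pair (λ c → w (e ⊕ c)) T) (P *ᴾ Q)
      ≈⟨ pair-*ᴾ _ P Q ⟩
    pair (λ a → pair (λ b → pair (λ c → w ((a ⊕ b) ⊕ c)) T) Q) P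
      ≈⟨ pair-cong P (λ a → pair-cong Q λ b → pair-cong T λ c → R.reflexive (≡.cong w (⊕-assoc a b c))) ⟩
    pair (λ a → pair (λ b → pair (λ c → w (a ⊕ (b ⊕ c))) T) Q) P
      ≈⟨ pair-cong P (λ a → pair-*ᴾ (λ e → w (a ⊕ e)) Q T) ⟨
    pair (λ a → pair (λ e → w (a ⊕ e)) (Q *ᴾ T)) P
      ≈⟨ pair-*ᴾ w P (Q *ᴾ T) ⟨
    pair w (P *ᴾ (Q *ᴾ T)) ∎

  *ᴾ-identityˡ : ∀ P → monomial 𝟘 *ᴾ P ≈ᴾ P
  *ᴾ-identityˡ P = pair⇒≈ λ w → begin
    pair w (monomial 𝟘 *ᴾ P)                  ≈⟨ pair-*ᴾ w (monomial 𝟘) P ⟩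
    1# * pair (λ b → w (𝟘 ⊕ b)) P + 0#        ≈⟨ R.trans (R.+-identityʳ _) (R.*-identityˡ _) ⟩
    pair (λ b → w (𝟘 ⊕ b)) P                  ≈⟨ pair-cong P (λ b → R.reflexive (≡.cong w (⊕-identityˡ b))) ⟩
    pair w P                                  ∎

  *ᴾ-distribˡ : ∀ P Q T → P *ᴾ (Q +ᴾ T) ≈ᴾ (P *ᴾ Q) +ᴾ (P *ᴾ T)
  *ᴾ-distribˡ P Q T = pair⇒≈ λ w → begin
    pair w (P *ᴾ (Q ++ T))
      ≈⟨ pair-*ᴾ w P (Q ++ T) ⟩
    pair (λ a → pair (λ b → w (a ⊕ b)) (Q ++ T)) P
      ≈⟨ pair-cong P (λ a → pair-++ _ Q T) ⟩
    pair (λ a → pair (λ b → w (a ⊕ b)) Q + pair (λ b → w (a ⊕ b)) T) P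
      ≈⟨ pair-+ _ _ P ⟩
    pair (λ a → pair (λ b → w (a ⊕ b)) Q) P + pair (λ a → pair (λ b → w (a ⊕ b)) T) P
      ≈⟨ R.+-cong (pair-*ᴾ w P Q) (pair-*ᴾ w P T) ⟨
    pair w (P *ᴾ Q) + pair w (P *ᴾ T)
      ≈⟨ pair-++ w (P *ᴾ Q) (P *ᴾ T) ⟨
    pair w ((P *ᴾ Q) ++ (P *ᴾ T)) ∎

  +ᴾ-cong : ∀ {P P′ Q Q′} → P ≈ᴾ P′ → Q ≈ᴾ Q′ → P +ᴾ Q ≈ᴾ P′ +ᴾ Q′
  +ᴾ-cong {P} {P′} {Q} {Q′} P≈P′ Q≈Q′ = pair⇒≈ λ w →
    R.trans (pair-++ w P Q)
      (R.trans (R.+-cong (≈⇒pair P≈P′ w) (≈⇒pair Q≈Q′ w)) (R.sym (pair-++ w P′ Q′)))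

  -ᴾ-cong : ∀ {P P′} → P ≈ᴾ P′ → (-ᴾ P) ≈ᴾ (-ᴾ P′)
  -ᴾ-cong {P} {P′} P≈P′ = pair⇒≈ λ w →
    R.trans (pair-neg w P) (R.trans (R.-‿cong (≈⇒pair P≈P′ w)) (R.sym (pair-neg w P′)))

  *ᴾ-cong : ∀ {P P′ Q Q′} → P ≈ᴾ P′ → Q ≈ᴾ Q′ → P *ᴾ Q ≈ᴾ P′ *ᴾ Q′
  *ᴾ-cong {P} {P′} {Q} {Q′} P≈P′ Q≈Q′ = pair⇒≈ λ w → begin
    pair w (P *ᴾ Q)                            ≈⟨ pair-*ᴾ w P Q ⟩
    pair (λ a → pair (λ b → w (a ⊕ b)) Q) P    ≈⟨ pair-cong P (λ a → ≈⇒pair Q≈Q′ (λ b → w (a ⊕ b))) ⟩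
    pair (λ a → pair (λ b → w (a ⊕ b)) Q′) P   ≈⟨ ≈⇒pair P≈P′ _ ⟩
    pair (λ a → pair (λ b → w (a ⊕ b)) Q′) P′  ≈⟨ pair-*ᴾ w P′ Q′ ⟨
    pair w (P′ *ᴾ Q′)                          ∎

  ≈ᴾ-sym : ∀ {P Q} → P ≈ᴾ Q → Q ≈ᴾ P
  ≈ᴾ-sym (coefficientwise e) = coefficientwise λ a → R.sym (e a)

  ≈ᴾ-trans : ∀ {P Q T} → P ≈ᴾ Q → Q ≈ᴾ T → P ≈ᴾ T
  ≈ᴾ-trans (coefficientwise e) (coefficientwise e′) = coefficientwise λ a → R.trans (e a) (e′ a)

  ≡⇒≈ᴾ : ∀ {P Q} → P ≡ Q → P ≈ᴾ Q
  ≡⇒≈ᴾ ≡.refl = coefficientwise λ _ → R.refl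

  polynomialRing : CommutativeRing r ℓr
  polynomialRing = record
    { Carrier = Poly
    ; _≈_ = _≈ᴾ_
    ; _+_ = _+ᴾ_
    ; _*_ = _*ᴾ_
    ; -_ = -ᴾ_
    ; 0# = []
    ; 1# = monomial 𝟘
    ; isCommutativeRing = record
      { isRing = record
        { +-isAbelianGroup = record
          { isGroup = record
            { isMonoid = record
              { isSemigroup = record
                { isMagma = record
                  { isEquivalence = record { refl = ≡⇒≈ᴾ ≡.refl ; sym = ≈ᴾ-sym ; trans = ≈ᴾ-trans }
                  ; ∙-cong = +ᴾ-cong
                  }
                ; assoc = λ P Q T → ≡⇒≈ᴾ (++-assoc P Q T)
                }
              ; identity = (λ P → ≡⇒≈ᴾ ≡.refl) , (λ P → ≡⇒≈ᴾ (++-identityʳ P))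
              }
            ; inverse = (λ P → ≈ᴾ-trans (+ᴾ-comm (-ᴾ P) P) (-ᴾ-inverseʳ P)) , -ᴾ-inverseʳ
            ; ⁻¹-cong = -ᴾ-cong
            }
          ; comm = +ᴾ-comm
          }
        ; *-cong = *ᴾ-cong
        ; *-assoc = *ᴾ-assoc
        ; *-identity = *ᴾ-identityˡ , (λ P → ≈ᴾ-trans (*ᴾ-comm P (monomial 𝟘)) (*ᴾ-identityˡ P))
        ; distrib = *ᴾ-distribˡ , λ P Q T → ≈ᴾ-trans (*ᴾ-comm (Q +ᴾ T) P)
            (≈ᴾ-trans (*ᴾ-distribˡ P Q T) (+ᴾ-cong (*ᴾ-comm P Q) (*ᴾ-comm P T)))
        }
      ; *-comm = *ᴾ-comm
      }
    }

  monomial-* : ∀ a b → monomial (a ⊕ b) ≈ᴾ monomial a *ᴾ monomial b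
  monomial-* a b = pair⇒≈ λ w → R.+-congʳ (R.*-congʳ (R.sym (R.*-identityˡ 1#)))

------------------------------------------------------------------------
-- Simplicial complexes and matroids on [n] = Fin n

-- Face is decidable because it stands for a subset of the finite set 2^[n].

record SimplicialComplex (n : ℕ) : Set₁ where
  field
    Face     : Pred (Subset n) 0ℓ
    face?    : Decidable Face
    downward : ∀ {F G} → G ⊆ F → Face F → Face G

record Matroid (n : ℕ) : Set₁ where
  field
    complex : SimplicialComplex n
  open SimplicialComplex complex public
    renaming (Face to Independent; face? to independent?; downward to hereditary)
  field
    nonempty : ∃[ I ] Independent I
    exchange : ∀ {I J} → Independent I → Independent J → ∣ J ∣ < ∣ I ∣ →
               ∃[ v ] v ∈ I × v ∉ J × Independent (J ∪ ⁅ v ⁆)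

  Maximal : Pred (Subset n) 0ℓ
  Maximal B = Independent B × (∀ {C} → Independent C → B ⊆ C → B ≡ C)

  private
    extend : ∀ I → Independent I → Acc _<_ (n ∸ ∣ I ∣) → ∃ Maximal
    extend I I∈ (acc rec) with Sub.anySubset? (λ C → independent? C ×-dec (I Sub.⊂? C))
    ... | yes (C , C∈ , I⊂C) = extend C C∈
          (rec (ℕₚ.∸-monoʳ-< (Sub.p⊂q⇒∣p∣<∣q∣ I⊂C) (Sub.∣p∣≤n C)))
    ... | no ¬∃C = I , I∈ , λ C∈ I⊆C → Sub.⊆-antisym I⊆C (C⊆I C∈ I⊆C)
      where
      C⊆I : ∀ {C} → Independent C → I ⊆ C → C ⊆ I
      C⊆I {C} C∈ I⊆C {x} x∈C with x Sub.∈? I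
      ... | yes x∈I = x∈I
      ... | no  x∉I = ⊥-elim (¬∃C (C , C∈ , I⊆C , x , x∈C , x∉I))

    maximal-≮ : ∀ {B C} → Maximal B → Maximal C → ¬ (∣ B ∣ < ∣ C ∣)
    maximal-≮ {B} {C} (B∈ , B-max) (C∈ , _) ∣B∣<∣C∣
      with v , _ , v∉B , B∪v∈ ← exchange C∈ B∈ ∣B∣<∣C∣ =
      v∉B (≡.subst (v ∈_) (≡.sym (B-max B∪v∈ (Sub.p⊆p∪q ⁅ v ⁆))) (Sub.q⊆p∪q B ⁅ v ⁆ (Sub.x∈⁅x⁆ v)))

  someMaximal : ∃ Maximal
  someMaximal = let I , I∈ = nonempty in extend I I∈ (<-wellFounded _)

  rank : ℕ
  rank = ∣ proj₁ someMaximal ∣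

  rank-common : ∀ {B} → Maximal B → ∣ B ∣ ≡ rank
  rank-common B-max = ℕₚ.≤-antisym
    (ℕₚ.≮⇒≥ (maximal-≮ (proj₂ someMaximal) B-max)) (ℕₚ.≮⇒≥ (maximal-≮ B-max (proj₂ someMaximal)))

  corank : ℕ
  corank = n ∸ rank

------------------------------------------------------------------------
-- Stanley–Reisner ideals

allSubsets : ∀ n → List (Subset n)
allSubsets zero    = [] ∷ []
allSubsets (suc n) = List.map (outside ∷_) (allSubsets n) ++ List.map (inside ∷_) (allSubsets n)

∈-allSubsets : ∀ {n} (F : Subset n) → F ListMem.∈ allSubsets n
∈-allSubsets []            = Any.here ≡.refl
∈-allSubsets (outside ∷ F) = ∈-++⁺ˡ (∈-map⁺ (outside ∷_) (∈-allSubsets F))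
∈-allSubsets {suc n} (inside ∷ F) =
  ∈-++⁺ʳ (List.map (outside ∷_) (allSubsets n)) (∈-map⁺ (inside ∷_) (∈-allSubsets F))

module _ {n : ℕ} (Δ : SimplicialComplex n) where
  open SimplicialComplex Δ

  MinimalNonface : Pred (Subset n) 0ℓ
  MinimalNonface F = ¬ Face F × ¬ (∃[ G ] G ⊂ F × ¬ Face G)

  minimalNonface? : Decidable MinimalNonface
  minimalNonface? F =
    ¬? (face? F) ×-dec ¬? (Sub.anySubset? λ G → (G Sub.⊂? F) ×-dec ¬? (face? G))

  minimalNonfaces : List (Subset n)
  minimalNonfaces = List.filter minimalNonface? (allSubsets n)

  minimalNonface⊆ : ∀ F → ¬ Face F → ∃[ G ] G ⊆ F × MinimalNonface G
  minimalNonface⊆ F F∉ = go F F∉ (<-wellFounded _)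
    where
    go : ∀ F → ¬ Face F → Acc _<_ ∣ F ∣ → ∃[ G ] G ⊆ F × MinimalNonface G
    go F F∉ (acc rec) with Sub.anySubset? (λ G → (G Sub.⊂? F) ×-dec ¬? (face? G))
    ... | no ¬∃G = F , Sub.⊆-refl , F∉ , ¬∃G
    ... | yes (G , G⊂F , G∉) with H , H⊆G , H-min ← go G G∉ (rec (Sub.p⊂q⇒∣p∣<∣q∣ G⊂F)) =
      H , Sub.⊆-trans H⊆G (Sub.p⊂q⇒p⊆q G⊂F) , H-min

-- The library's notion of field is that of a Heyting field; every field with
-- decidable equality is one, with ≉ as its apartness relation.

module StanleyReisner (K : HeytingField r ℓr p) {n : ℕ} (Δ : SimplicialComplex n) where

  open SimplicialComplex Δ
  open Polynomial (HeytingCommutativeRing.commutativeRing (HeytingField.heytingCommutativeRing K)) n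
    using (Poly; monomial; monomial-*; polynomialRing)

  S : CommutativeRing r ℓr
  S = polynomialRing

  -- ∏_{i ∈ F} xᵢ
  𝐱^ : Subset n → Poly
  𝐱^ F = monomial (Vec.map (λ b → if b then 1 else 0) F)

  I_Δ : Ideal S (r ⊔ ℓr)
  I_Δ = span ⟨module⟩ λ P → ∃[ F ] ¬ Face F × P ≡ 𝐱^ F

  -- 𝐱^ G divides 𝐱^ F exactly when G ⊆ F, so the minimal monomial generators
  -- are the 𝐱^ F with F a minimal nonface.
  #generators : ℕ
  #generators = length (minimalNonfaces Δ)

  generator : Vector Poly #generators
  generator i = 𝐱^ (List.lookup (minimalNonfaces Δ) i)

  private
    module S = CommutativeRing S

  generator∈I : ∀ i → Member I_Δ (generator i)
  generator∈I i = gen (_ , proj₁ (proj₂ (∈-filter⁻ (minimalNonface? Δ) {xs = allSubsets n}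
                                        (∈-lookup {xs = minimalNonfaces Δ} i))) , ≡.refl)

  I⊆⟨generators⟩ : ∀ {P} → Member I_Δ P → Member (im (linearCombination {R = S} generator)) P
  I⊆⟨generators⟩ = span-least ⟨module⟩ (im (linearCombination {R = S} generator)) nonface
    where
    open SemiringSum S.semiring using (sum; sum-cong-≋; sum-replicate-zero)

    unit : ∀ {k} → Fin k → Vector Poly k
    unit Fin.zero    Fin.zero    = S.1#
    unit Fin.zero    (Fin.suc _) = S.0#
    unit (Fin.suc _) Fin.zero    = S.0#
    unit (Fin.suc i) (Fin.suc j) = unit i j

    sum-unit : ∀ {k} (i : Fin k) (g : Vector Poly k) → sum (λ j → unit i j S.* g j) S.≈ g i
    sum-unit {suc k} Fin.zero g = S.trans
      (S.+-cong (S.*-identityˡ (g Fin.zero)) (S.trans (sum-cong-≋ λ j → S.zeroˡ (g (Fin.suc j))) (sum-replicate-zero k)))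
      (S.+-identityʳ (g Fin.zero))
    sum-unit {suc k} (Fin.suc i) g = S.trans
      (S.+-cong (S.zeroˡ (g Fin.zero)) (sum-unit i (g ∘ Fin.suc)))
      (S.+-identityˡ (g (Fin.suc i)))

    generated : ∀ i → Member (im (linearCombination {R = S} generator)) (generator i)
    generated i = unit i , sum-unit i generator

    split : ∀ {k} {G F : Subset k} → G ⊆ F →
      let χ = Vec.map (λ b → if b then 1 else 0) in
      ∃[ a ] Vec.zipWith ℕ._+_ a (χ G) ≡ χ F
    split {G = []}          {[]}          G⊆F = [] , ≡.refl
    split {G = inside  ∷ G} {outside ∷ F} G⊆F with () ← G⊆F Vec.here
    split {G = outside ∷ G} {b ∷ F}       G⊆F =
      let a , e = split (Sub.drop-∷-⊆ G⊆F) in (if b then 1 else 0) ∷ a , ≡.cong₂ _∷_ (ℕₚ.+-identityʳ _) e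
    split {G = inside  ∷ G} {inside ∷ F}  G⊆F =
      let a , e = split (Sub.drop-∷-⊆ G⊆F) in 0 ∷ a , ≡.cong (1 ∷_) e

    nonface : ∀ {P} → (∃[ F ] ¬ Face F × P ≡ 𝐱^ F) → Member (im (linearCombination {R = S} generator)) P
    nonface (F , F∉ , ≡.refl)
      with G , G⊆F , G-min ← minimalNonface⊆ Δ F F∉
      with a , a+χG≡χF ← split G⊆F =
      Submodule.resp im-d
        (S.trans (S.sym (monomial-* a _)) (S.reflexive (≡.cong monomial a+χG≡χF)))
        (Submodule.*∈ im-d (monomial a) 𝐱^G∈im)
      where
      im-d = im (linearCombination {R = S} generator)
      G∈ : G ListMem.∈ minimalNonfaces Δ
      G∈ = ∈-filter⁺ (minimalNonface? Δ) (∈-allSubsets G) G-min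
      𝐱^G∈im : Member im-d (𝐱^ G)
      𝐱^G∈im = ≡.subst (λ H → Member im-d (𝐱^ H)) (≡.sym (lookup-index G∈)) (generated (Any.index G∈))

module _ (K : HeytingField r ℓr p) {n : ℕ} (Δ : SimplicialComplex n) where
  open StanleyReisner K Δ

  T² : Module (quotientRing I_Δ) (r ⊔ ℓr) (r ⊔ ℓr)
  T² = SecondCotangentCohomology.T² S I_Δ generator generator∈I I⊆⟨generators⟩

{-# OPTIONS --safe #-}

-- If M has corank at most two, then every circuit of M is contained in the
-- union of any two distinct circuits.  Hence, for U the union of all circuits
-- C₁, …, Cₖ, the monomials qᵢ = x^(U ∖ Cᵢ) are pairwise coprime and
-- qᵢ x^Cᵢ = x^U for all i.  The syzygies of the generators x^Cᵢ are therefore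
-- the vectors (qᵢ bᵢ) with ∑ bᵢ = 0.  Given ψ : Syz/Kosz → S/I, put
-- tᵢ = ψ(qᵢ eᵢ − q₀ e₀).  Since ψ kills the Koszul relations,
-- tᵢ ≡ tⱼ mod (qᵢ , qⱼ); the Chinese remainder theorem for monomial ideals
-- gives a t with tᵢ = t + qᵢ aᵢ for all i, and then ψ is the restriction of
-- h ↦ ∑ hᵢ aᵢ because ∑ bᵢ = 0.
module Submission where

open import Defs
open import Algebra.Apartness.Bundles using (HeytingField; HeytingCommutativeRing)
open import Algebra.Bundles using (CommutativeRing)
open import Algebra.Module.Bundles using (Module)
import Algebra.Properties.AbelianGroup as AbelianGroupProperties
import Algebra.Properties.CommutativeMonoid.Sum as CommutativeMonoidSum
import Algebra.Properties.CommutativeSemigroup as CommutativeSemigroupProperties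
import Algebra.Properties.Ring as RingProperties
import Algebra.Properties.Semiring.Sum as SemiringSum
open import Data.Bool.Base using (if_then_else_)
open import Data.Fin.Base using (Fin; zero; suc)
import Data.Fin.Properties as Finₚ
open import Data.Fin.Subset using (Subset; inside; outside; _∈_; _∉_; _⊆_; _⊂_; _∪_; ⋃; ⁅_⁆; ∣_∣; ⊤) renaming (_-_ to _∖_)
import Data.Fin.Subset.Properties as Sub
open import Data.List.Base as List using (List; []; _∷_; _++_; length)
import Data.List.Membership.Propositional as ListMem
open import Data.List.Membership.Propositional.Properties using (∈-filter⁻; ∈-lookup; ∈-map⁻)
import Data.List.Relation.Unary.All as All
open import Data.List.Relation.Unary.AllPairs using ([]; _∷_)
import Data.List.Relation.Unary.Any as Any
open import Data.List.Relation.Unary.Unique.Propositional using (Unique)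
import Data.List.Relation.Unary.Unique.Propositional.Properties as Uniqueₚ
open import Data.Nat.Base as ℕ using (ℕ; zero; suc; _∸_; _≤_; _<_; s≤s)
open import Data.Nat.Induction using (<-wellFounded)
import Data.Nat.Properties as ℕₚ
open import Data.Product.Base using (∃-syntax; Σ-syntax; _×_; _,_; proj₁; proj₂)
open import Data.Sum.Base using (_⊎_; inj₁; inj₂; [_,_]′)
open import Data.Vec.Base as Vec using (Vec; _∷_; lookup; there)
open import Data.Vec.Functional using (Vector)
open import Data.Vec.Properties
  using (lookup-zipWith; lookup-map; lookup⇒[]=; []=⇒lookup; tabulate-cong; tabulate∘lookup; zipWith-comm; ∷-injectiveʳ)
open import Function.Base using (_∘_; case_of_)
open import Function.Bundles using (mk⇔)
open import Induction.WellFounded using (Acc; acc)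
open import Level using (Level)
open import Relation.Binary.PropositionalEquality as ≡ using (_≡_; _≢_)
import Relation.Binary.Reasoning.Setoid as SetoidReasoning
open import Relation.Nullary using (¬_; Dec; yes; no; ¬?; _×-dec_; contradiction)
open import Relation.Nullary.Decidable using (decidable-stable; does-⇔; dec-false)
open import Relation.Unary using (Pred; Decidable)

private variable
  r ℓr m₁ m₂ ℓm₁ ℓm₂ p : Level


-- Finite sums and standard basis vectors

sum-homo : {R : CommutativeRing r ℓr} {M : Module R m₁ ℓm₁} {N : Module R m₂ ℓm₂} (f : Hom M N) →
  let module M = Module M
      module N = Module N
      open CommutativeMonoidSum M.+ᴹ-commutativeMonoid using () renaming (sum to ∑ᴹ)
      open CommutativeMonoidSum N.+ᴹ-commutativeMonoid using () renaming (sum to ∑ᴺ)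
  in ∀ {k} (v : Vector M.Carrierᴹ k) → ⟦ f ⟧ (∑ᴹ v) N.≈ᴹ ∑ᴺ (⟦ f ⟧ ∘ v)
sum-homo {N = N} f {zero} v = Hom.0ᴹ-homo f
sum-homo {N = N} f {suc k} v =
  N.≈ᴹ-trans (Hom.+ᴹ-homo f (v zero) _) (N.+ᴹ-congˡ (sum-homo f (v ∘ suc)))
  where module N = Module N

module FiniteSums (R : CommutativeRing r ℓr) where
  open CommutativeRing R hiding (zero)
  open SemiringSum semiring using (sum; sum-cong-≋; sum-replicate-zero)

  basis : ∀ {k} → Fin k → Vector Carrier k
  basis zero    zero    = 1#
  basis zero    (suc _) = 0#
  basis (suc _) zero    = 0#
  basis (suc i) (suc j) = basis i j

  basis-symmetric : ∀ {k} (i j : Fin k) → basis i j ≡ basis j i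
  basis-symmetric zero    zero    = ≡.refl
  basis-symmetric zero    (suc _) = ≡.refl
  basis-symmetric (suc _) zero    = ≡.refl
  basis-symmetric (suc i) (suc j) = basis-symmetric i j

  -- Away from i = j both sides vanish. This lets a factor indexed by the running coordinate be
  -- replaced by a constant one.
  *-basis : ∀ {k} (f : Vector Carrier k) i j → f j * basis i j ≈ f i * basis i j
  *-basis f zero    zero    = refl
  *-basis f zero    (suc _) = trans (zeroʳ _) (sym (zeroʳ _))
  *-basis f (suc _) zero    = trans (zeroʳ _) (sym (zeroʳ _))
  *-basis f (suc i) (suc j) = *-basis (f ∘ suc) i j

  sum-basis-* : ∀ {k} i (f : Vector Carrier k) → sum (λ j → basis i j * f j) ≈ f i
  sum-basis-* {suc k} zero    f = trans
    (+-cong (*-identityˡ _) (trans (sum-cong-≋ (λ j → zeroˡ (f (suc j)))) (sum-replicate-zero k)))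
    (+-identityʳ _)
  sum-basis-* {suc k} (suc i) f = trans (+-cong (zeroˡ _) (sum-basis-* i (f ∘ suc))) (+-identityˡ _)

  sum-*-basis : ∀ {k} j (f : Vector Carrier k) → sum (λ i → f i * basis i j) ≈ f j
  sum-*-basis j f = trans
    (sum-cong-≋ (λ i → trans (*-comm _ _) (*-congʳ (reflexive (basis-symmetric i j)))))
    (sum-basis-* j f)

  sum-basis : ∀ {k} (i : Fin k) → sum (basis i) ≈ 1#
  sum-basis i = trans (sum-cong-≋ {x = basis i} λ j → sym (*-identityʳ (basis i j))) (sum-basis-* i (λ _ → 1#))

  sum-single : ∀ {k} (f : Vector Carrier k) i → (∀ j → j ≢ i → f j ≈ 0#) → sum f ≈ f i
  sum-single {suc k} f zero    f≈0 = trans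
    (+-congˡ (trans (sum-cong-≋ λ j → f≈0 (suc j) λ ()) (sum-replicate-zero k)))
    (+-identityʳ _)
  sum-single {suc k} f (suc i) f≈0 = trans
    (+-cong (f≈0 zero λ ()) (sum-single (f ∘ suc) i λ j j≢i → f≈0 (suc j) (j≢i ∘ Finₚ.suc-injective)))
    (+-identityˡ _)

-- Extending homomorphisms from Syz/Kosz to the free module

module _
  {r ℓr p : Level} (S : CommutativeRing r ℓr) (I : Ideal S p)
  {k : ℕ} (g : Vector (CommutativeRing.Carrier S) k) (g∈I : ∀ i → Member I (g i))
  (I⊆⟨g⟩ : ∀ a → Member I a → Member (im (linearCombination {R = S} g)) a)
  where
  open CommutativeRing S hiding (zero)
  open Quotient I
  open SecondCotangentCohomology S I g g∈I (λ {a} → I⊆⟨g⟩ a)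
    using (d; Syz; Kosz; S/I; S/Iˢ; Syz/Kosz; restrict; restriction)

  -- A class in the cokernel is zero as soon as its representative has a preimage, and `ext ψ` is
  -- such a preimage.
  restrict-surjective⇒T²-zero : (∀ (ψ : Hom Syz/Kosz S/I) → Σ[ φ ∈ Hom (Free S k) S/Iˢ ] (restrict φ ≗ʰ ψ)) →
    IsZero (SecondCotangentCohomology.T² S I g g∈I (λ {a} → I⊆⟨g⟩ a))
  restrict-surjective⇒T²-zero ext ψ = Quotient.∼0⁺ (im restriction) (ext ψ)

  modI : Vector Carrier k → Hom (Free S k) S/Iˢ
  modI a = mkHom ⟦ linearCombination {R = S} a ⟧
    (λ x≈y → ≈⇒∼ (Hom.⟦⟧-cong (linearCombination {R = S} a) x≈y))
    (λ x y → ≈⇒∼ (Hom.+ᴹ-homo (linearCombination {R = S} a) x y))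
    (λ b x → ≈⇒∼ (Hom.*ₗ-homo (linearCombination {R = S} a) b x))

  -- In the application `g i` = u / `q i` for pairwise coprime monomials `q i`, and `D i j` = u /
  -- (`q i` `q j`). The colon ideal I : `D i j` is then (`q i`, `q j`), so the premise of `crt` is
  -- the usual congruence of `t i` and `t j`, phrased without that ideal. The conclusion of `crt` is
  -- an equation in S, not only modulo I.
  module CoprimeCofactors
    (q : Vector Carrier k) (u : Carrier) (q*g≈u : ∀ i → q i * g i ≈ u)
    (u-regular : ∀ x → x * u ≈ 0# → x ≈ 0#)
    (q-divides : ∀ h → ⟦ linearCombination {R = S} g ⟧ h ≈ 0# → Σ[ b ∈ Vector Carrier k ] (∀ i → h i ≈ q i * b i))
    (D : ∀ i j → i ≢ j → Carrier)
    (D*q≈g : ∀ i j i≢j → D i j i≢j * q i ≈ g j × D i j i≢j * q j ≈ g i)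
    (crt : (t : Vector Carrier k) → (∀ i j i≢j → (D i j i≢j * t i) ∼ (D i j i≢j * t j)) →
           Σ[ t₀ ∈ Carrier ] Σ[ a ∈ Vector Carrier k ] (∀ i → t i ≈ t₀ + q i * a i))
    where

    private
      module SyzM = Module (toModule Syz)

    open FiniteSums S
    open RingProperties ring using (-‿distribʳ-*; x[y-z]≈xy-xz)
    open AbelianGroupProperties +-abelianGroup using (⁻¹-∙-comm)
    open CommutativeSemigroupProperties *-commutativeSemigroup using (x∙yz≈y∙xz)
    open CommutativeSemigroupProperties +-commutativeSemigroup using (interchange)
    open SemiringSum semiring using (sum; sum-cong-≋; ∑-distrib-+; *-distribˡ-sum; *-distribʳ-sum)
    open CommutativeMonoidSum SyzM.+ᴹ-commutativeMonoid using () renaming (sum to ∑ˢ)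
    open SetoidReasoning setoid

    difference-cancel : ∀ x y z → (x - z) - (y - z) ≈ x - y
    difference-cancel x y z = begin
      (x - z) - (y - z)       ≈⟨ +-congˡ (⁻¹-∙-comm y (- z)) ⟨
      (x - z) + (- y - - z)   ≈⟨ interchange x (- z) (- y) (- - z) ⟩
      (x - y) + (- z - - z)   ≈⟨ +-congˡ (-‿inverseʳ (- z)) ⟩
      (x - y) + 0#            ≈⟨ +-identityʳ _ ⟩
      x - y                   ∎

    d-q* : ∀ (b : Vector Carrier k) → ⟦ d ⟧ (λ i → q i * b i) ≈ sum b * u
    d-q* b = begin
      sum (λ i → q i * b i * g i)
        ≈⟨ sum-cong-≋ (λ i → trans (*-congʳ (*-comm (q i) (b i))) (trans (*-assoc _ _ _) (*-congˡ (q*g≈u i)))) ⟩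
      sum (λ i → b i * u)            ≈⟨ *-distribʳ-sum u b ⟨
      sum b * u                      ∎

    -- The syzygies are the vectors (qₗ bₗ) with ∑ bₗ = 0; this is the one with b = eᵢ − eⱼ.
    σ : Fin k → Fin k → SyzM.Carrierᴹ
    σ j i = (λ l → q l * (basis i l - basis j l)) , (begin
      ⟦ d ⟧ (λ l → q l * (basis i l - basis j l)) ≈⟨ d-q* (λ l → basis i l - basis j l) ⟩
      sum (λ l → basis i l - basis j l) * u         ≈⟨ *-congʳ sum≈0 ⟩
      0# * u                                        ≈⟨ zeroˡ u ⟩
      0#                                            ∎)
      where
      sum≈0 : sum (λ l → basis i l - basis j l) ≈ 0#
      sum≈0 = begin
        sum (λ l → basis i l - basis j l)                ≈⟨ ∑-distrib-+ (basis i) (λ l → - basis j l) ⟩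
        sum (basis i) + sum (λ l → - basis j l)
          ≈⟨ +-cong (sum-basis i) (sum-cong-≋ (λ l → trans (-‿cong (sym (*-identityʳ _))) (-‿distribʳ-* (basis j l) 1#))) ⟩
        1# + sum (λ l → basis j l * - 1#)                ≈⟨ +-congˡ (sum-basis-* j (λ _ → - 1#)) ⟩
        1# - 1#                                          ≈⟨ -‿inverseʳ 1# ⟩
        0#                                               ∎

    -- The terms at `o` cancel, and D (qᵢ eᵢ - qⱼ eⱼ) = gⱼ eᵢ - gᵢ eⱼ is the Koszul relation of eⱼ
    -- and eᵢ.
    D-σ : ∀ {i j} (i≢j : i ≢ j) o → Member Kosz ((D i j i≢j SyzM.*ₗ σ o i) SyzM.+ᴹ (SyzM.-ᴹ (D i j i≢j SyzM.*ₗ σ o j)))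
    D-σ {i} {j} i≢j o = resp koszul≈ (gen (basis j , basis i , ≡.refl))
      where
      δ = D i j i≢j
      expand : ∀ m l → δ * (q l * (basis m l - basis o l)) ≈ δ * q m * basis m l - δ * q l * basis o l
      expand m l = begin
        δ * (q l * (basis m l - basis o l))        ≈⟨ *-assoc _ _ _ ⟨
        δ * q l * (basis m l - basis o l)          ≈⟨ x[y-z]≈xy-xz _ _ _ ⟩
        -- `basis m l` is zero unless l = m. The subtracted term keeps its index `l`, so it is the
        -- same for m = i and m = j and can cancel.
        δ * q l * basis m l - δ * q l * basis o l  ≈⟨ +-congʳ (*-basis (λ l′ → δ * q l′) m l) ⟩
        δ * q m * basis m l - δ * q l * basis o l  ∎
      koszul≈ : ∀ l → ⟦ d ⟧ (basis j) * basis i l - ⟦ d ⟧ (basis i) * basis j l ≈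
                      δ * (q l * (basis i l - basis o l)) - δ * (q l * (basis j l - basis o l))
      koszul≈ l = begin
        ⟦ d ⟧ (basis j) * basis i l - ⟦ d ⟧ (basis i) * basis j l
          ≈⟨ +-cong (*-congʳ (sum-basis-* j g)) (-‿cong (*-congʳ (sum-basis-* i g))) ⟩
        g j * basis i l - g i * basis j l
          ≈⟨ +-cong (*-congʳ (proj₁ (D*q≈g i j i≢j))) (-‿cong (*-congʳ (proj₂ (D*q≈g i j i≢j)))) ⟨
        δ * q i * basis i l - δ * q j * basis j l
          ≈⟨ difference-cancel _ _ _ ⟨
        (δ * q i * basis i l - δ * q l * basis o l) - (δ * q j * basis j l - δ * q l * basis o l)
          ≈⟨ +-cong (expand i l) (-‿cong (expand j l)) ⟨
        δ * (q l * (basis i l - basis o l)) - δ * (q l * (basis j l - basis o l)) ∎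

    ∑ˢ-coordinate : ∀ {j} (v : Vector SyzM.Carrierᴹ j) l → proj₁ (∑ˢ v) l ≈ sum (λ i → proj₁ (v i) l)
    ∑ˢ-coordinate {zero}  v l = refl
    ∑ˢ-coordinate {suc j} v l = +-congˡ (∑ˢ-coordinate (v ∘ suc) l)

    -- Applying `d` to (qᵢ bᵢ) gives (∑ b) u, and u is a nonzerodivisor.
    sum-coefficients : ∀ (h : SyzM.Carrierᴹ) (b : Vector Carrier k) → (∀ i → proj₁ h i ≈ q i * b i) → sum b ≈ 0#
    sum-coefficients (h , d[h]≈0) b h≈q*b = u-regular (sum b)
      (trans (sym (d-q* b)) (trans (Hom.⟦⟧-cong d (λ i → sym (h≈q*b i))) d[h]≈0))

    -- Coordinate l of the right side is q l times `b l` - (∑ b) `basis o l`; since ∑ b = 0, the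
    -- contribution of the base index disappears.
    ∑-σ : ∀ o (h : SyzM.Carrierᴹ) (b : Vector Carrier k) → (∀ i → proj₁ h i ≈ q i * b i) →
      h SyzM.≈ᴹ ∑ˢ (λ i → b i SyzM.*ₗ σ o i)
    ∑-σ o h b h≈q*b l = sym (begin
      proj₁ (∑ˢ (λ i → b i SyzM.*ₗ σ o i)) l
        ≈⟨ ∑ˢ-coordinate (λ i → b i SyzM.*ₗ σ o i) l ⟩
      sum (λ i → b i * (q l * (basis i l - basis o l)))
        ≈⟨ sum-cong-≋ (λ i → x∙yz≈y∙xz (b i) (q l) _) ⟩
      sum (λ i → q l * (b i * (basis i l - basis o l)))
        ≈⟨ *-distribˡ-sum (q l) (λ i → b i * (basis i l - basis o l)) ⟨
      q l * sum (λ i → b i * (basis i l - basis o l))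
        ≈⟨ *-congˡ (sum-cong-≋ (λ i → distribˡ (b i) (basis i l) (- basis o l))) ⟩
      q l * sum (λ i → b i * basis i l + b i * - basis o l)
        ≈⟨ *-congˡ (∑-distrib-+ (λ i → b i * basis i l) (λ i → b i * - basis o l)) ⟩
      q l * (sum (λ i → b i * basis i l) + sum (λ i → b i * - basis o l))
        ≈⟨ *-congˡ (+-cong (sum-*-basis l b) (sym (*-distribʳ-sum (- basis o l) b))) ⟩
      q l * (b l + sum b * - basis o l)
        ≈⟨ *-congˡ (+-congˡ (trans (*-congʳ (sum-coefficients h b h≈q*b)) (zeroˡ _))) ⟩
      q l * (b l + 0#)
        ≈⟨ *-congˡ (+-identityʳ (b l)) ⟩
      q l * b l
        ≈⟨ h≈q*b l ⟨
      proj₁ h l ∎)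

    module _ (ψ : Hom Syz/Kosz S/I) where

      ∑-∼ : ∀ {j} {v w : Vector Carrier j} → (∀ i → v i ∼ w i) → sum v ∼ sum w
      ∑-∼ {zero}  e = ≈⇒∼ refl
      ∑-∼ {suc j} e = ∼-+-cong (e zero) (∑-∼ (e ∘ suc))

      -- Passing from Syz to Syz/Kosz changes the equality but not the addition, so `∑ˢ` is also the
      -- sum in the source of `ψ`.
      ψ-∑ˢ : ∀ {j} (v : Vector SyzM.Carrierᴹ j) → ⟦ ψ ⟧ (∑ˢ v) ∼ sum (⟦ ψ ⟧ ∘ v)
      ψ-∑ˢ v = sum-homo ψ v

      ψ-cong : ∀ (x y : SyzM.Carrierᴹ) → x SyzM.≈ᴹ y → ⟦ ψ ⟧ x ∼ ⟦ ψ ⟧ y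
      ψ-cong x y x≈y = Hom.⟦⟧-cong ψ (Quotient.≈⇒∼ Kosz {x = x} {y = y} x≈y)

      ψ-expand : ∀ o (z : SyzM.Carrierᴹ) (b : Vector Carrier k) → (∀ i → proj₁ z i ≈ q i * b i) →
        ⟦ ψ ⟧ z ∼ sum (λ i → b i * ⟦ ψ ⟧ (σ o i))
      ψ-expand o z b z≈q*b = ∼-trans (ψ-cong z (∑ˢ (λ i → b i SyzM.*ₗ σ o i)) (∑-σ o z b z≈q*b))
        (∼-trans (ψ-∑ˢ (λ i → b i SyzM.*ₗ σ o i)) (∑-∼ λ i → Hom.*ₗ-homo ψ (b i) (σ o i)))

      -- By `D-σ` the corresponding multiples of `σ o i` and `σ o j` are one element of Syz/Kosz.
      -- This is the premise of `crt` for tᵢ = ψ (σ o i).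
      ψ-compatible : ∀ o i j i≢j → (D i j i≢j * ⟦ ψ ⟧ (σ o i)) ∼ (D i j i≢j * ⟦ ψ ⟧ (σ o j))
      ψ-compatible o i j i≢j =
        ∼-trans (∼-sym (Hom.*ₗ-homo ψ (D i j i≢j) (σ o i)))
          (∼-trans (Hom.⟦⟧-cong ψ (Quotient.congruent (D-σ i≢j o)))
            (Hom.*ₗ-homo ψ (D i j i≢j) (σ o j)))

    -- The common part `t₀` enters with the factor ∑ b = 0, so only the parts qᵢ aᵢ of the tᵢ
    -- survive, and qᵢ bᵢ is the coordinate of `z`.
    sum-expand : ∀ (t : Vector Carrier k) (t₀ : Carrier) (a : Vector Carrier k) → (∀ i → t i ≈ t₀ + q i * a i) →
      ∀ (z : SyzM.Carrierᴹ) (b : Vector Carrier k) → (∀ i → proj₁ z i ≈ q i * b i) →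
      sum (λ i → proj₁ z i * a i) ≈ sum (λ i → b i * t i)
    sum-expand t t₀ a t≈ z b z≈q*b = begin
      sum (λ i → proj₁ z i * a i)
        ≈⟨ sum-cong-≋ (λ i → trans (*-congʳ (trans (z≈q*b i) (*-comm _ _))) (*-assoc _ _ _)) ⟩
      sum (λ i → b i * (q i * a i))
        ≈⟨ +-identityˡ _ ⟨
      0# + sum (λ i → b i * (q i * a i))
        ≈⟨ +-congʳ (trans (*-congʳ (sum-coefficients z b z≈q*b)) (zeroˡ t₀)) ⟨
      sum b * t₀ + sum (λ i → b i * (q i * a i))
        ≈⟨ +-congʳ (*-distribʳ-sum t₀ b) ⟩
      sum (λ i → b i * t₀) + sum (λ i → b i * (q i * a i))
        ≈⟨ ∑-distrib-+ (λ i → b i * t₀) (λ i → b i * (q i * a i)) ⟨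
      sum (λ i → b i * t₀ + b i * (q i * a i))
        ≈⟨ sum-cong-≋ (λ i → trans (*-congˡ (t≈ i)) (distribˡ (b i) t₀ (q i * a i))) ⟨
      sum (λ i → b i * t i) ∎

    -- The index `o` is the base point for the differences `σ o i`; any choice will do.
    extension : Fin k → ∀ (ψ : Hom Syz/Kosz S/I) →
      Σ[ a ∈ Vector Carrier k ] (∀ z → ⟦ linearCombination {R = S} a ⟧ (proj₁ z) ∼ ⟦ ψ ⟧ z)
    extension o ψ = let t₀ , a , t≈ = crt (λ i → ⟦ ψ ⟧ (σ o i)) (ψ-compatible ψ o) in a , λ z →
      let b , z≈q*b = q-divides (proj₁ z) (proj₂ z) in
      ∼-trans (≈⇒∼ (sum-expand (λ i → ⟦ ψ ⟧ (σ o i)) t₀ a t≈ z b z≈q*b)) (∼-sym (ψ-expand ψ o z b z≈q*b))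

    extension-∅ : ¬ Fin k → ∀ (ψ : Hom Syz/Kosz S/I) →
      Σ[ a ∈ Vector Carrier k ] (∀ z → ⟦ linearCombination {R = S} a ⟧ (proj₁ z) ∼ ⟦ ψ ⟧ z)
    -- `g` stands for the empty vector: its linear combination is `d`, which is zero on a syzygy by
    -- definition. On the other side, every syzygy equals 0 because it has no coordinates.
    extension-∅ empty ψ = g , λ z → ∼-trans (≈⇒∼ (proj₂ z)) (∼-sym
      (∼-trans (Hom.⟦⟧-cong ψ (Quotient.≈⇒∼ Kosz {x = z} {y = SyzM.0ᴹ} (λ i → contradiction i empty))) (Hom.0ᴹ-homo ψ)))

    T²-vanishes : IsZero (SecondCotangentCohomology.T² S I g g∈I (λ {a} → I⊆⟨g⟩ a))
    T²-vanishes = restrict-surjective⇒T²-zero λ ψ → let a , a≗ψ = extend ψ in modI a , pointwise a≗ψ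
      where
      inhabited : ∀ j → Fin j ⊎ ¬ Fin j
      inhabited zero    = inj₂ λ ()
      inhabited (suc _) = inj₁ zero
      extend : ∀ (ψ : Hom Syz/Kosz S/I) →
        Σ[ a ∈ Vector Carrier k ] (∀ z → ⟦ linearCombination {R = S} a ⟧ (proj₁ z) ∼ ⟦ ψ ⟧ z)
      extend = case inhabited k of λ where
        (inj₁ o)     → extension o
        (inj₂ empty) → extension-∅ empty

-- Exponent vectors and divisibility of monomials

module Exponents (n : ℕ) where

  Exponent : Set
  Exponent = Vec ℕ n

  infixl 6 _⊕_ _⊖_
  infix 4 _≼_

  _⊕_ _⊖_ : Exponent → Exponent → Exponent
  _⊕_ = Vec.zipWith ℕ._+_
  _⊖_ = Vec.zipWith _∸_

  _≼_ : Exponent → Exponent → Set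
  a ≼ e = ∀ v → lookup a v ≤ lookup e v

  _≼?_ : ∀ a e → Dec (a ≼ e)
  a ≼? e = Finₚ.all? λ v → lookup a v ℕₚ.≤? lookup e v

  ⋠⇒< : ∀ a e → ¬ (a ≼ e) → ∃[ v ] lookup e v < lookup a v
  ⋠⇒< a e a⋠e with v , av≰ev ← Finₚ.¬∀⟶∃¬ n _ (λ v → lookup a v ℕₚ.≤? lookup e v) a⋠e = v , ℕₚ.≰⇒> av≰ev

  lookup-ext : ∀ {a b : Exponent} → (∀ v → lookup a v ≡ lookup b v) → a ≡ b
  lookup-ext {a} {b} e = ≡.trans (≡.sym (tabulate∘lookup a)) (≡.trans (tabulate-cong e) (tabulate∘lookup b))

  lookup-⊕ : ∀ a b v → lookup (a ⊕ b) v ≡ lookup a v ℕ.+ lookup b v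
  lookup-⊕ a b v = lookup-zipWith ℕ._+_ v a b

  lookup-⊖ : ∀ a b v → lookup (a ⊖ b) v ≡ lookup a v ∸ lookup b v
  lookup-⊖ a b v = lookup-zipWith _∸_ v a b

  ≼-⊕ : ∀ a b → a ≼ a ⊕ b
  ≼-⊕ a b v = ≡.subst (lookup a v ≤_) (≡.sym (lookup-⊕ a b v)) (ℕₚ.m≤m+n _ _)

  ⊕-⊖-cancel : ∀ a b → (a ⊕ b) ⊖ a ≡ b
  ⊕-⊖-cancel a b = lookup-ext λ v → ≡.trans (lookup-⊖ (a ⊕ b) a v)
    (≡.trans (≡.cong (_∸ lookup a v) (lookup-⊕ a b v)) (ℕₚ.m+n∸m≡n (lookup a v) _))

  ⊕-⊖ : ∀ {a e} → a ≼ e → a ⊕ (e ⊖ a) ≡ e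
  ⊕-⊖ {a} {e} a≼e = lookup-ext λ v → ≡.trans (lookup-⊕ a (e ⊖ a) v)
    (≡.trans (≡.cong (lookup a v ℕ.+_) (lookup-⊖ e a v)) (ℕₚ.m+[n∸m]≡n (a≼e v)))

  ⊕-cancelˡ : ∀ a {b c} → a ⊕ b ≡ a ⊕ c → b ≡ c
  ⊕-cancelˡ a {b} {c} e = ≡.trans (≡.sym (⊕-⊖-cancel a b)) (≡.trans (≡.cong (_⊖ a) e) (⊕-⊖-cancel a c))

-- Coefficients, division by a monomial, and gluing of polynomials

module Coefficients (R : CommutativeRing r ℓr) (n : ℕ) where
  open CommutativeRing R hiding (zero)
  open Polynomial R n hiding (_⊕_; Exponent)
  open Exponents n
  open SetoidReasoning setoid
  open SemiringSum semiring using (sum; sum-cong-≋; sum-replicate-zero)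
  open SemiringSum (CommutativeRing.semiring polynomialRing) using () renaming (sum to sumᴾ)

  coeff-++ : ∀ P Q e → coeff (P ++ Q) e ≈ coeff P e + coeff Q e
  coeff-++ P Q e = trans (coeff≈pair (P ++ Q) e)
    (trans (pair-++ (δ e) P Q) (sym (+-cong (coeff≈pair P e) (coeff≈pair Q e))))

  coeff-neg : ∀ P e → coeff (-ᴾ P) e ≈ - coeff P e
  coeff-neg P e = trans (coeff≈pair (-ᴾ P) e) (trans (pair-neg (δ e) P) (-‿cong (sym (coeff≈pair P e))))

  coeff-sum : ∀ {k} (f : Vector Poly k) e → coeff (sumᴾ f) e ≈ sum (λ i → coeff (f i) e)
  coeff-sum {zero}  f e = refl
  coeff-sum {suc k} f e = trans (coeff-++ (f zero) _ e) (+-congˡ (coeff-sum (f ∘ suc) e))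

  -- Multiplication by xᵃ becomes a shift of the functional `δ e`; the next two lemmas ask which b
  -- satisfy a ⊕ b = e.
  coeff-monomial-* : ∀ a P e → coeff (monomial a *ᴾ P) e ≈ pair (λ b → δ e (a ⊕ b)) P
  coeff-monomial-* a P e = begin
    coeff (monomial a *ᴾ P) e                   ≈⟨ coeff≈pair (monomial a *ᴾ P) e ⟩
    pair (δ e) (monomial a *ᴾ P)                ≈⟨ pair-*ᴾ (δ e) (monomial a) P ⟩
    1# * pair (λ b → δ e (a ⊕ b)) P + 0#        ≈⟨ trans (+-identityʳ _) (*-identityˡ _) ⟩
    pair (λ b → δ e (a ⊕ b)) P                  ∎

  coeff-monomial-*-⊕ : ∀ a P e → coeff (monomial a *ᴾ P) (a ⊕ e) ≈ coeff P e
  coeff-monomial-*-⊕ a P e = begin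
    coeff (monomial a *ᴾ P) (a ⊕ e)    ≈⟨ coeff-monomial-* a P (a ⊕ e) ⟩
    pair (λ b → δ (a ⊕ e) (a ⊕ b)) P
      ≈⟨ pair-cong P (λ b → reflexive (≡.cong (if_then 1# else 0#)
           (does-⇔ (mk⇔ (⊕-cancelˡ a) (≡.cong (a ⊕_))) ((a ⊕ b) ≟ (a ⊕ e)) (b ≟ e)))) ⟩
    pair (δ e) P                       ≈⟨ coeff≈pair P e ⟨
    coeff P e                          ∎

  coeff-monomial-*-⋠ : ∀ {a} P {e} → ¬ (a ≼ e) → coeff (monomial a *ᴾ P) e ≈ 0#
  coeff-monomial-*-⋠ {a} P {e} a⋠e = begin
    coeff (monomial a *ᴾ P) e     ≈⟨ coeff-monomial-* a P e ⟩
    pair (λ b → δ e (a ⊕ b)) P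
      ≈⟨ pair-cong P (λ b → reflexive (≡.cong (if_then 1# else 0#)
           (dec-false ((a ⊕ b) ≟ e) λ { ≡.refl → a⋠e (≼-⊕ a b) }))) ⟩
    pair (λ _ → 0#) P             ≈⟨ pair-zero P ⟩
    0#                            ∎

  monomial-regular : ∀ a {P} → monomial a *ᴾ P ≈ᴾ [] → P ≈ᴾ []
  monomial-regular a {P} (coefficientwise aP≈0) =
    coefficientwise λ e → trans (sym (coeff-monomial-*-⊕ a P e)) (aP≈0 (a ⊕ e))

  -- Division with the remainder forgotten: terms that xᵃ does not divide are dropped.
  div : Exponent → Poly → Poly
  div a []            = []
  div a ((c , b) ∷ P) with a ≼? b
  ... | yes _ = (c , b ⊖ a) ∷ div a P
  ... | no  _ = div a P

  coeff-div : ∀ a P e → coeff (div a P) e ≈ coeff P (a ⊕ e)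
  coeff-div a []            e = refl
  coeff-div a ((c , b) ∷ P) e with a ≼? b
  ... | yes a≼b = +-cong (reflexive (≡.cong (if_then c else 0#)
          (does-⇔ (mk⇔ (λ { ≡.refl → ≡.sym (⊕-⊖ a≼b) }) (λ { ≡.refl → ⊕-⊖-cancel a e })) ((b ⊖ a) ≟ e) (b ≟ (a ⊕ e)))))
        (coeff-div a P e)
  ... | no  a⋠b = begin
    coeff (div a P) e                 ≈⟨ coeff-div a P e ⟩
    coeff P (a ⊕ e)                   ≈⟨ +-identityˡ _ ⟨
    0# + coeff P (a ⊕ e)
      ≈⟨ +-congʳ (reflexive (≡.cong (if_then c else 0#) (dec-false (b ≟ (a ⊕ e)) λ { ≡.refl → a⋠b (≼-⊕ a e) }))) ⟨
    coeff ((c , b) ∷ P) (a ⊕ e)       ∎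

  -- The hypothesis is on coefficients rather than on listed terms, since a formal sum may contain
  -- terms that cancel one another.
  monomial-*-div : ∀ a P → (∀ e → ¬ (a ≼ e) → coeff P e ≈ 0#) → P ≈ᴾ monomial a *ᴾ div a P
  monomial-*-div a P zero-off = coefficientwise λ e → case a ≼? e of λ where
    (yes a≼e) → begin
      coeff P e                                       ≈⟨ reflexive (≡.cong (coeff P) (⊕-⊖ a≼e)) ⟨
      coeff P (a ⊕ (e ⊖ a))                           ≈⟨ coeff-div a P (e ⊖ a) ⟨
      coeff (div a P) (e ⊖ a)                         ≈⟨ coeff-monomial-*-⊕ a (div a P) (e ⊖ a) ⟨
      coeff (monomial a *ᴾ div a P) (a ⊕ (e ⊖ a))     ≈⟨ reflexive (≡.cong (coeff (monomial a *ᴾ div a P)) (⊕-⊖ a≼e)) ⟩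
      coeff (monomial a *ᴾ div a P) e                 ∎
    (no a⋠e) → trans (zero-off e a⋠e) (sym (coeff-monomial-*-⋠ (div a P) a⋠e))

  module _ {Q : Pred Exponent p} (Q? : Decidable Q) where

    restrictTo : Poly → Poly
    restrictTo = List.filter (λ (_ , b) → Q? b)

    coeff-restrictTo : ∀ P {e} → Q e → coeff (restrictTo P) e ≈ coeff P e
    coeff-restrictTo []            Qe = refl
    coeff-restrictTo ((c , b) ∷ P) {e} Qe with Q? b
    ... | yes _  = +-congˡ (coeff-restrictTo P Qe)
    ... | no ¬Qb = begin
      coeff (restrictTo P) e   ≈⟨ coeff-restrictTo P Qe ⟩
      coeff P e                ≈⟨ +-identityˡ _ ⟨
      0# + coeff P e
        ≈⟨ +-congʳ (reflexive (≡.cong (if_then c else 0#) (dec-false (b ≟ e) λ { ≡.refl → ¬Qb Qe }))) ⟨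
      coeff ((c , b) ∷ P) e    ∎

    coeff-restrictTo-¬ : ∀ P {e} → ¬ Q e → coeff (restrictTo P) e ≈ 0#
    coeff-restrictTo-¬ []            ¬Qe = refl
    coeff-restrictTo-¬ ((c , b) ∷ P) {e} ¬Qe with Q? b
    ... | no _   = coeff-restrictTo-¬ P ¬Qe
    ... | yes Qb = trans
      (+-cong (reflexive (≡.cong (if_then c else 0#) (dec-false (b ≟ e) λ { ≡.refl → ¬Qe Qb }))) (coeff-restrictTo-¬ P ¬Qe))
      (+-identityˡ 0#)

  -- The coefficient at e is that of the first tᵢ with x^qᵢ ∤ xᵉ, and 0 if there is none.
  glue : ∀ {k} → Vector Exponent k → Vector Poly k → Poly
  glue {zero}  q t = []
  glue {suc k} q t = restrictTo (λ b → ¬? (q zero ≼? b)) (t zero) ++ restrictTo (q zero ≼?_) (glue (q ∘ suc) (t ∘ suc))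

  -- The coefficient comes from the first index whose monomial does not divide xᵉ, and `agree`
  -- carries it over to `i`. Where x^qᵢ does divide xᵉ nothing is claimed: a discrepancy there is
  -- absorbed by a multiple of x^qᵢ.
  coeff-glue : ∀ {k} (q : Vector Exponent k) (t : Vector Poly k) e →
    (∀ i j → ¬ (q i ≼ e) → ¬ (q j ≼ e) → coeff (t i) e ≈ coeff (t j) e) →
    ∀ i → ¬ (q i ≼ e) → coeff (glue q t) e ≈ coeff (t i) e
  coeff-glue {suc k} q t e agree i qᵢ⋠e with q zero ≼? e
  ... | no q₀⋠e = begin
    coeff (glue q t) e
      ≈⟨ coeff-++ (restrictTo (λ b → ¬? (q zero ≼? b)) (t zero)) _ e ⟩
    coeff (restrictTo (λ b → ¬? (q zero ≼? b)) (t zero)) e + coeff (restrictTo (q zero ≼?_) (glue (q ∘ suc) (t ∘ suc))) e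
      ≈⟨ +-cong (coeff-restrictTo (λ b → ¬? (q zero ≼? b)) (t zero) q₀⋠e)
           (coeff-restrictTo-¬ (q zero ≼?_) (glue (q ∘ suc) (t ∘ suc)) q₀⋠e) ⟩
    coeff (t zero) e + 0#     ≈⟨ +-identityʳ _ ⟩
    coeff (t zero) e          ≈⟨ agree zero i q₀⋠e qᵢ⋠e ⟩
    coeff (t i) e             ∎
  coeff-glue {suc k} q t e agree zero    qᵢ⋠e | yes q₀≼e = contradiction q₀≼e qᵢ⋠e
  coeff-glue {suc k} q t e agree (suc i) qᵢ⋠e | yes q₀≼e = begin
    coeff (glue q t) e
      ≈⟨ coeff-++ (restrictTo (λ b → ¬? (q zero ≼? b)) (t zero)) _ e ⟩
    coeff (restrictTo (λ b → ¬? (q zero ≼? b)) (t zero)) e + coeff (restrictTo (q zero ≼?_) (glue (q ∘ suc) (t ∘ suc))) e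
      ≈⟨ +-cong (coeff-restrictTo-¬ (λ b → ¬? (q zero ≼? b)) (t zero) (λ q₀⋠e → q₀⋠e q₀≼e))
           (coeff-restrictTo (q zero ≼?_) (glue (q ∘ suc) (t ∘ suc)) q₀≼e) ⟩
    0# + coeff (glue (q ∘ suc) (t ∘ suc)) e     ≈⟨ +-identityˡ _ ⟩
    coeff (glue (q ∘ suc) (t ∘ suc)) e
      ≈⟨ coeff-glue (q ∘ suc) (t ∘ suc) e (λ i j → agree (suc i) (suc j)) i qᵢ⋠e ⟩
    coeff (t (suc i)) e                         ∎

  -- The ideal generated by the monomials x^(u - qᵢ), for pairwise coprime x^qᵢ
  module CoprimeMonomials {k : ℕ}
    (c q : Vector Exponent k) (u : Exponent) (q⊕c≡u : ∀ i → q i ⊕ c i ≡ u)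
    (coprime : ∀ i j → i ≢ j → ∀ v → lookup (q i) v ≡ 0 ⊎ lookup (q j) v ≡ 0)
    where

    private
      module S = CommutativeRing polynomialRing
    open FiniteSums R using (sum-single)
    open RingProperties ring using (x∙y⁻¹≈ε⇒x≈y)

    q+c≡u : ∀ i v → lookup (q i) v ℕ.+ lookup (c i) v ≡ lookup u v
    q+c≡u i v = ≡.trans (≡.sym (lookup-⊕ (q i) (c i) v)) (≡.cong (λ a → lookup a v) (q⊕c≡u i))

    c≤u : ∀ i v → lookup (c i) v ≤ lookup u v
    c≤u i v = ≡.subst (lookup (c i) v ≤_) (q+c≡u i v) (ℕₚ.m≤n+m _ _)

    -- At v the exponent of qₘ is positive, so by coprimality that of qₗ is 0 and cₗ attains u
    -- there; but d + e stays strictly below d + qₘ, hence below u.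
    c-⋠ : ∀ {l m v} d e → l ≢ m → lookup e v < lookup (q m) v → lookup d v ℕ.+ lookup (q m) v ≤ lookup u v → ¬ (c l ≼ d ⊕ e)
    c-⋠ {l} {m} {v} d e l≢m ev<qv d+q≤u c≼d⊕e with coprime l m l≢m v
    ... | inj₂ qm≡0 = ℕₚ.n≮0 (≡.subst (lookup e v <_) qm≡0 ev<qv)
    ... | inj₁ ql≡0 = ℕₚ.<-irrefl ≡.refl (ℕₚ.<-≤-trans (ℕₚ.+-monoʳ-< (lookup d v) ev<qv) (ℕₚ.≤-trans d+q≤u u≤d+e))
      where
      u≤d+e : lookup u v ≤ lookup d v ℕ.+ lookup e v
      u≤d+e = ≡.subst₂ _≤_ (≡.trans (≡.cong (ℕ._+ lookup (c l) v) (≡.sym ql≡0)) (q+c≡u l v)) (lookup-⊕ d e v) (c≼d⊕e v)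

    -- cᵢ − qⱼ = u − qᵢ − qⱼ, hence the symmetry in i and j.
    c⊖q⊕q≡c : ∀ i j → i ≢ j → (c i ⊖ q j) ⊕ q i ≡ c j × (c i ⊖ q j) ⊕ q j ≡ c i
    c⊖q⊕q≡c i j i≢j =
      lookup-ext (λ v → ≡.trans (lookup-d⊕ (q i) v) (proj₁ (at v))) ,
      lookup-ext (λ v → ≡.trans (lookup-d⊕ (q j) v) (proj₂ (at v)))
      where
      lookup-d⊕ : ∀ a v → lookup ((c i ⊖ q j) ⊕ a) v ≡ lookup (c i) v ∸ lookup (q j) v ℕ.+ lookup a v
      lookup-d⊕ a v = ≡.trans (lookup-⊕ (c i ⊖ q j) a v) (≡.cong (ℕ._+ lookup a v) (lookup-⊖ (c i) (q j) v))
      at : ∀ v → lookup (c i) v ∸ lookup (q j) v ℕ.+ lookup (q i) v ≡ lookup (c j) v ×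
                 lookup (c i) v ∸ lookup (q j) v ℕ.+ lookup (q j) v ≡ lookup (c i) v
      -- Where qᵢ vanishes, cᵢ = u = qⱼ + cⱼ, so the truncated subtraction is exact; where qⱼ
      -- vanishes, nothing is subtracted.
      at v with lookup (q i) v | lookup (q j) v | coprime i j i≢j v | q+c≡u i v | q+c≡u j v
      ... | _ | qj | inj₁ ≡.refl | ci≡u | qj+cj≡u rewrite ≡.trans ci≡u (≡.sym qj+cj≡u) =
        ≡.trans (ℕₚ.+-identityʳ _) (ℕₚ.m+n∸m≡n qj _) , ℕₚ.m∸n+n≡m (ℕₚ.m≤m+n qj _)
      ... | qi | _ | inj₂ ≡.refl | qi+ci≡u | cj≡u =
        ≡.trans (ℕₚ.+-comm _ qi) (≡.trans qi+ci≡u (≡.sym cj≡u)) , ℕₚ.+-identityʳ _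

    -- Each summand is a multiple of some x^cₗ. This turns membership in the ideal into vanishing of
    -- coefficients.
    coeff-combination : ∀ (f : Vector Poly k) {P} → sumᴾ (λ l → f l *ᴾ monomial (c l)) ≈ᴾ P →
      ∀ e → (∀ l → ¬ (c l ≼ e)) → coeff P e ≈ 0#
    coeff-combination f {P} (coefficientwise f≈P) e c⋠e = begin
      coeff P e                                        ≈⟨ f≈P e ⟨
      coeff (sumᴾ (λ l → f l *ᴾ monomial (c l))) e     ≈⟨ coeff-sum (λ l → f l *ᴾ monomial (c l)) e ⟩
      sum (λ l → coeff (f l *ᴾ monomial (c l)) e)
        ≈⟨ sum-cong-≋ (λ l → trans (_≈ᴾ_.at (*ᴾ-comm (f l) (monomial (c l))) e) (coeff-monomial-*-⋠ (f l) (c⋠e l))) ⟩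
      sum {k} (λ _ → 0#)                               ≈⟨ sum-replicate-zero k ⟩
      0#                                               ∎

    -- If x^qᵢ does not divide xᵉ, then by `c-⋠` no x^cⱼ with j ≠ i divides x^(cᵢ + e). Only the
    -- i-th summand of the relation contributes to that coefficient, and its contribution is the
    -- coefficient of hᵢ at e.
    syzygy-divisible : ∀ (h : Vector Poly k) → sumᴾ (λ i → h i *ᴾ monomial (c i)) ≈ᴾ [] →
      ∀ i → h i ≈ᴾ monomial (q i) *ᴾ div (q i) (h i)
    syzygy-divisible h (coefficientwise d[h]≈0) i = monomial-*-div (q i) (h i) λ e q⋠e →
      let v , ev<qv = ⋠⇒< (q i) e q⋠e in begin
      coeff (h i) e
        ≈⟨ coeff-monomial-*-⊕ (c i) (h i) e ⟨
      coeff (monomial (c i) *ᴾ h i) (c i ⊕ e)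
        ≈⟨ sum-single (λ j → coeff (monomial (c j) *ᴾ h j) (c i ⊕ e)) i
             (λ j j≢i → coeff-monomial-*-⋠ (h j) (c-⋠ (c i) e j≢i ev<qv
               (ℕₚ.≤-reflexive (≡.trans (ℕₚ.+-comm _ (lookup (q i) v)) (q+c≡u i v))))) ⟨
      sum (λ j → coeff (monomial (c j) *ᴾ h j) (c i ⊕ e))
        ≈⟨ sum-cong-≋ (λ j → _≈ᴾ_.at (*ᴾ-comm (h j) (monomial (c j))) (c i ⊕ e)) ⟨
      sum (λ j → coeff (h j *ᴾ monomial (c j)) (c i ⊕ e))
        ≈⟨ coeff-sum (λ j → h j *ᴾ monomial (c j)) (c i ⊕ e) ⟨
      coeff (sumᴾ (λ j → h j *ᴾ monomial (c j))) (c i ⊕ e)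
        ≈⟨ d[h]≈0 (c i ⊕ e) ⟩
      0# ∎

    D : ∀ (i j : Fin k) → i ≢ j → Poly
    D i j _ = monomial (c i ⊖ q j)

    module _ (t : Vector Poly k)
      (compatible : ∀ i j i≢j → Σ[ f ∈ Vector Poly k ]
          (sumᴾ (λ l → f l *ᴾ monomial (c l)) ≈ᴾ D i j i≢j *ᴾ t i S.- D i j i≢j *ᴾ t j)) where

      -- With d = u - qᵢ - qⱼ, no generator divides x^(d + e). The element x^d (tᵢ - tⱼ) of the
      -- ideal therefore has coefficient 0 there, and this coefficient is the difference of the two
      -- sides.
      coeff-agree : ∀ e i j → ¬ (q i ≼ e) → ¬ (q j ≼ e) → coeff (t i) e ≈ coeff (t j) e
      coeff-agree e i j qi⋠e qj⋠e with i Finₚ.≟ j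
      ... | yes ≡.refl = refl
      ... | no i≢j = x∙y⁻¹≈ε⇒x≈y _ _ (begin
        coeff (t i) e - coeff (t j) e
          ≈⟨ +-cong (coeff-monomial-*-⊕ d (t i) e) (-‿cong (coeff-monomial-*-⊕ d (t j) e)) ⟨
        coeff (monomial d *ᴾ t i) (d ⊕ e) - coeff (monomial d *ᴾ t j) (d ⊕ e)
          ≈⟨ +-congˡ (coeff-neg (monomial d *ᴾ t j) (d ⊕ e)) ⟨
        coeff (monomial d *ᴾ t i) (d ⊕ e) + coeff (-ᴾ (monomial d *ᴾ t j)) (d ⊕ e)
          ≈⟨ coeff-++ (monomial d *ᴾ t i) _ (d ⊕ e) ⟨
        coeff (monomial d *ᴾ t i S.- monomial d *ᴾ t j) (d ⊕ e)
          ≈⟨ coeff-combination (proj₁ (compatible i j i≢j)) (proj₂ (compatible i j i≢j)) (d ⊕ e) d⊕e∉I ⟩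
        0# ∎)
        where
        d = c i ⊖ q j
        bound : ∀ m m′ → d ⊕ q m ≡ c m′ → ∀ v → lookup d v ℕ.+ lookup (q m) v ≤ lookup u v
        bound m m′ d⊕q≡c v = ≡.subst (_≤ lookup u v)
          (≡.trans (≡.cong (λ a → lookup a v) (≡.sym d⊕q≡c)) (lookup-⊕ d (q m) v)) (c≤u m′ v)
        d⊕e∉I : ∀ l → ¬ (c l ≼ d ⊕ e)
        -- `c-⋠` asks for an index other than `l` whose monomial does not divide xᵉ: i serves unless
        -- l = i, and then j does.
        d⊕e∉I l with l Finₚ.≟ i
        ... | no  l≢i    = let v , ev<qv = ⋠⇒< (q i) e qi⋠e in c-⋠ d e l≢i ev<qv (bound i j (proj₁ (c⊖q⊕q≡c i j i≢j)) v)
        ... | yes ≡.refl = let v , ev<qv = ⋠⇒< (q j) e qj⋠e in c-⋠ d e i≢j ev<qv (bound j i (proj₂ (c⊖q⊕q≡c i j i≢j)) v)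

      glue-remainder : ∀ i → t i S.- glue q t ≈ᴾ monomial (q i) *ᴾ div (q i) (t i S.- glue q t)
      glue-remainder i = monomial-*-div (q i) (t i S.- glue q t) λ e q⋠e → begin
        coeff (t i S.- glue q t) e             ≈⟨ coeff-++ (t i) _ e ⟩
        coeff (t i) e + coeff (-ᴾ glue q t) e  ≈⟨ +-congˡ (coeff-neg (glue q t) e) ⟩
        coeff (t i) e - coeff (glue q t) e     ≈⟨ +-congˡ (-‿cong (coeff-glue q t e (coeff-agree e) i q⋠e)) ⟩
        coeff (t i) e - coeff (t i) e          ≈⟨ -‿inverseʳ _ ⟩
        0#                                     ∎

      chinese-remainder : ∀ i → t i ≈ᴾ glue q t S.+ monomial (q i) *ᴾ div (q i) (t i S.- glue q t)
      chinese-remainder i = S.trans (S.sym (xyx⁻¹≈y (glue q t) (t i)))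
        (S.trans (S.+-assoc (glue q t) (t i) _) (S.+-congˡ {x = glue q t} (glue-remainder i)))
        where
        open RingProperties S.ring using (xyx⁻¹≈y)

    monomial-⊕ : ∀ {a b a⊕b} → a ⊕ b ≡ a⊕b → monomial a *ᴾ monomial b ≈ᴾ monomial a⊕b
    monomial-⊕ {a} {b} ≡.refl = S.sym (monomial-* a b)

-- Finite subsets and their cardinalities

⊈⇒∃ : ∀ {n} {p q : Subset n} → ¬ (p ⊆ q) → ∃[ v ] v ∈ p × v ∉ q
⊈⇒∃ {p = p} {q} p⊈q with Finₚ.any? (λ v → (v Sub.∈? p) ×-dec ¬? (v Sub.∈? q))
... | yes found  = found
... | no  ¬found = contradiction (λ {v} v∈p → decidable-stable (v Sub.∈? q) λ v∉q → ¬found (v , v∈p , v∉q)) p⊈q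

x∉p-x : ∀ {n} (p : Subset n) x → x ∉ p ∖ x
x∉p-x (_ ∷ p) zero    ()
x∉p-x (s ∷ p) (suc x) (there x∈) = x∉p-x p x x∈

∣p∣≤1+∣p-x∣ : ∀ {n} (p : Subset n) x → ∣ p ∣ ≤ suc ∣ p ∖ x ∣
∣p∣≤1+∣p-x∣ (inside  ∷ p) zero    = s≤s (ℕₚ.≤-reflexive (≡.cong ∣_∣ (≡.sym (Sub.p─⊥≡p p))))
∣p∣≤1+∣p-x∣ (outside ∷ p) zero    = ℕₚ.m≤n⇒m≤1+n (ℕₚ.≤-reflexive (≡.cong ∣_∣ (≡.sym (Sub.p─⊥≡p p))))
∣p∣≤1+∣p-x∣ (inside  ∷ p) (suc x) = s≤s (∣p∣≤1+∣p-x∣ p x)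
∣p∣≤1+∣p-x∣ (outside ∷ p) (suc x) = ∣p∣≤1+∣p-x∣ p x

misses-two : ∀ {n} {p q : Subset n} {x y} → p ⊆ q → x ∈ q → y ∈ q → x ≢ y → x ∉ p → y ∉ p → suc (suc ∣ p ∣) ≤ ∣ q ∣
misses-two {p = p} {q} {x} {y} p⊆q x∈q y∈q x≢y x∉p y∉p = begin
  suc (suc ∣ p ∣)           ≤⟨ s≤s (s≤s (Sub.p⊆q⇒∣p∣≤∣q∣ p⊆q-x-y)) ⟩
  suc (suc ∣ q ∖ x ∖ y ∣)   ≤⟨ s≤s (Sub.x∈p⇒∣p-x∣<∣p∣ (Sub.x∈p∧x≢y⇒x∈p-y y∈q (x≢y ∘ ≡.sym))) ⟩
  suc ∣ q ∖ x ∣             ≤⟨ Sub.x∈p⇒∣p-x∣<∣p∣ x∈q ⟩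
  ∣ q ∣                     ∎
  where
  open ℕₚ.≤-Reasoning
  p⊆q-x-y : p ⊆ q ∖ x ∖ y
  p⊆q-x-y v∈p = Sub.x∈p∧x≢y⇒x∈p-y
    (Sub.x∈p∧x≢y⇒x∈p-y (p⊆q v∈p) λ { ≡.refl → x∉p v∈p }) λ { ≡.refl → y∉p v∈p }

-- Circuits of a matroid

module Circuits {n : ℕ} (M : Matroid n) where
  open Matroid M

  Circuit : Subset n → Set
  Circuit = MinimalNonface complex

  remove-independent : ∀ {C} → Circuit C → ∀ {x} → x ∈ C → Independent (C ∖ x)
  remove-independent {C} (_ , minimal) {x} x∈C = decidable-stable (independent? (C ∖ x)) λ dependent →
    minimal (C ∖ x , (Sub.p─q⊆p C ⁅ x ⁆ , x , x∈C , x∉p-x C x) , dependent)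

  circuit-⊈ : ∀ {C C′} → Circuit C → Circuit C′ → C ≢ C′ → ¬ (C ⊆ C′)
  circuit-⊈ {C} {C′} (C∉ , _) (_ , minimal′) C≢C′ C⊆C′ with C′ Sub.⊆? C
  ... | yes C′⊆C = C≢C′ (Sub.⊆-antisym C⊆C′ C′⊆C)
  ... | no  C′⊈C = minimal′ (C , (C⊆C′ , ⊈⇒∃ C′⊈C) , C∉)

  circuit-meets-complement : ∀ {C I} → Circuit C → Independent I → ∃[ v ] v ∈ C × v ∉ I
  circuit-meets-complement (C∉ , _) I∈ = ⊈⇒∃ λ C⊆I → C∉ (hereditary C⊆I I∈)

  -- The exchange axiom adds elements of `J` one at a time until the set is as large as `J`; n minus
  -- its size decreases.
  augment : ∀ {I J} → Independent I → Independent J →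
    ∃[ I′ ] Independent I′ × I ⊆ I′ × I′ ⊆ I ∪ J × ∣ J ∣ ≤ ∣ I′ ∣
  augment {I} {J} I∈ J∈ = go I I∈ Sub.⊆-refl (Sub.p⊆p∪q J) (<-wellFounded _)
    where
    go : ∀ I₁ → Independent I₁ → I ⊆ I₁ → I₁ ⊆ I ∪ J → Acc _<_ (n ∸ ∣ I₁ ∣) →
      ∃[ I′ ] Independent I′ × I ⊆ I′ × I′ ⊆ I ∪ J × ∣ J ∣ ≤ ∣ I′ ∣
    go I₁ I₁∈ I⊆I₁ I₁⊆I∪J (acc rec) with ∣ I₁ ∣ ℕₚ.<? ∣ J ∣
    ... | no  ≮ = I₁ , I₁∈ , I⊆I₁ , I₁⊆I∪J , ℕₚ.≮⇒≥ ≮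
    ... | yes ∣I₁∣<∣J∣ with v , v∈J , v∉I₁ , I₁∪v∈ ← exchange J∈ I₁∈ ∣I₁∣<∣J∣ =
      go (I₁ ∪ ⁅ v ⁆) I₁∪v∈ (Sub.⊆-trans I⊆I₁ (Sub.p⊆p∪q ⁅ v ⁆)) I₁∪v⊆I∪J
        (rec (ℕₚ.∸-monoʳ-< (Sub.p⊂q⇒∣p∣<∣q∣ I₁⊂I₁∪v) (Sub.∣p∣≤n (I₁ ∪ ⁅ v ⁆))))
      where
      I₁⊂I₁∪v : I₁ ⊂ I₁ ∪ ⁅ v ⁆
      I₁⊂I₁∪v = Sub.p⊆p∪q ⁅ v ⁆ , v , Sub.q⊆p∪q I₁ ⁅ v ⁆ (Sub.x∈⁅x⁆ v) , v∉I₁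
      I₁∪v⊆I∪J : I₁ ∪ ⁅ v ⁆ ⊆ I ∪ J
      I₁∪v⊆I∪J w∈ with Sub.x∈p∪q⁻ I₁ ⁅ v ⁆ w∈
      ... | inj₁ w∈I₁ = I₁⊆I∪J w∈I₁
      ... | inj₂ w∈v  = Sub.q⊆p∪q I J (≡.subst (_∈ J) (≡.sym (Sub.x∈⁅y⁆⇒x≡y v w∈v)) v∈J)

  -- Weak circuit elimination
  union-minus-dependent : ∀ {C C′} → Circuit C → Circuit C′ → C ≢ C′ → ∀ w → ¬ Independent (C ∪ C′ ∖ w)
  union-minus-dependent {C} {C′} circuit circuit′ C≢C′ w A-w∈
    -- Write A = C ∪ C′. The independent set C - y is enlarged by elements of A - w to an
    -- independent `I` at least as large as A - w.
    with y , y∈C , y∉C′ ← ⊈⇒∃ (circuit-⊈ circuit circuit′ C≢C′)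
    with I , I∈ , C-y⊆I , I⊆ , ∣A-w∣≤∣I∣ ← augment (remove-independent circuit y∈C) A-w∈
    with z , z∈C′ , z∉I ← circuit-meets-complement circuit′ I∈ =
    -- `I` lies in A and misses both y and z, so its size is at most |A| - 2, which is less than |A
    -- - w|. The point y is missed because `I` contains C - y and cannot contain all of C.
    ℕₚ.<-irrefl ≡.refl (ℕₚ.≤-trans
      (misses-two I⊆A (Sub.p⊆p∪q C′ y∈C) (Sub.q⊆p∪q C C′ z∈C′) (λ { ≡.refl → y∉C′ z∈C′ }) y∉I z∉I)
      (ℕₚ.≤-trans (∣p∣≤1+∣p-x∣ (C ∪ C′) w) (s≤s ∣A-w∣≤∣I∣)))
    where
    I⊆A : I ⊆ C ∪ C′
    I⊆A v∈I with Sub.x∈p∪q⁻ (C ∖ y) (C ∪ C′ ∖ w) (I⊆ v∈I)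
    ... | inj₁ v∈C-y = Sub.p⊆p∪q C′ (Sub.p─q⊆p C ⁅ y ⁆ v∈C-y)
    ... | inj₂ v∈A-w = Sub.p─q⊆p (C ∪ C′) ⁅ w ⁆ v∈A-w
    y∉I : y ∉ I
    y∉I y∈I with v , v∈C , v∉I ← circuit-meets-complement circuit I∈ with v Finₚ.≟ y
    ... | yes ≡.refl = v∉I y∈I
    ... | no  v≢y    = v∉I (C-y⊆I (Sub.x∈p∧x≢y⇒x∈p-y v∈C v≢y))

  -- Three distinct elements outside `B` would give rank + 3 ≤ n, that is, corank at least 3.
  misses-at-most-two : corank ≤ 2 → ∀ {B} → Independent B → rank ≤ ∣ B ∣ →
    ∀ {x y z} → x ∉ B → y ∉ B → z ∉ B → x ≢ y → x ≢ z → y ≡ z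
  misses-at-most-two corank≤2 {B} B∈ rank≤ {x} {y} {z} x∉B y∉B z∉B x≢y x≢z with y Finₚ.≟ z
  ... | yes y≡z = y≡z
  ... | no  y≢z = contradiction corank≤2 (ℕₚ.<⇒≱ (ℕₚ.+-cancelʳ-≤ rank 3 corank (begin
    3 ℕ.+ rank             ≤⟨ ℕₚ.+-monoʳ-≤ 3 rank≤ ⟩
    3 ℕ.+ ∣ B ∣            ≤⟨ s≤s (misses-two B⊆⊤-x (in⊤-x y∉B x≢y) (in⊤-x z∉B x≢z) y≢z y∉B z∉B) ⟩
    suc ∣ ⊤ {n} ∖ x ∣      ≤⟨ Sub.x∈p⇒∣p-x∣<∣p∣ {x = x} {p = ⊤ {n}} Sub.∈⊤ ⟩
    ∣ ⊤ {n} ∣              ≡⟨ Sub.∣⊤∣≡n n ⟩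
    n                      ≡⟨ ℕₚ.m∸n+n≡m (Sub.∣p∣≤n (proj₁ someMaximal)) ⟨
    corank ℕ.+ rank        ∎)))
    where
    open ℕₚ.≤-Reasoning
    in⊤-x : ∀ {v} → v ∉ B → x ≢ v → v ∈ ⊤ ∖ x
    in⊤-x _ x≢v = Sub.x∈p∧x≢y⇒x∈p-y Sub.∈⊤ (x≢v ∘ ≡.sym)
    B⊆⊤-x : B ⊆ ⊤ ∖ x
    B⊆⊤-x v∈B = Sub.x∈p∧x≢y⇒x∈p-y Sub.∈⊤ λ { ≡.refl → x∉B v∈B }

  -- Suppose e in C″ lies outside A = C ∪ C′. Enlarge C″ - e to an independent `B` of at least full
  -- rank. It misses e, since it cannot contain C″, and it misses some v in C. As the corank is at
  -- most two it misses nothing else, so A - v lies in `B`, contrary to weak elimination.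
  circuit-⊆-union : corank ≤ 2 → ∀ {C C′ C″} → Circuit C → Circuit C′ → C ≢ C′ → Circuit C″ → C″ ⊆ C ∪ C′
  circuit-⊆-union corank≤2 {C} {C′} {C″} circuit circuit′ C≢C′ circuit″ {e} e∈C″ =
    decidable-stable (e Sub.∈? (C ∪ C′)) outside-impossible
    where
    outside-impossible : ¬ (e ∉ C ∪ C′)
    outside-impossible e∉A
      with B , B∈ , C″-e⊆B , _ , rank≤∣B∣ ← augment (remove-independent circuit″ e∈C″) (proj₁ (proj₂ someMaximal))
      with v″ , v″∈C″ , v″∉B ← circuit-meets-complement circuit″ B∈
      with v , v∈C , v∉B ← circuit-meets-complement circuit B∈ =
      union-minus-dependent circuit circuit′ C≢C′ v (hereditary A-v⊆B B∈)
      where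
      e∉B : e ∉ B
      e∉B with v″ Finₚ.≟ e
      ... | yes ≡.refl = v″∉B
      ... | no  v″≢e   = contradiction (C″-e⊆B (Sub.x∈p∧x≢y⇒x∈p-y v″∈C″ v″≢e)) v″∉B
      A∌e : ∀ {u} → u ∈ C ∪ C′ → e ≢ u
      A∌e u∈A ≡.refl = e∉A u∈A
      A-v⊆B : C ∪ C′ ∖ v ⊆ B
      A-v⊆B {u} u∈A-v with u Sub.∈? B
      ... | yes u∈B = u∈B
      ... | no  u∉B = contradiction
        (≡.subst (_∈ C ∪ C′ ∖ v)
          (misses-at-most-two corank≤2 B∈ rank≤∣B∣ e∉B u∉B v∉B
            (A∌e (Sub.p─q⊆p (C ∪ C′) ⁅ v ⁆ u∈A-v)) (A∌e (Sub.p⊆p∪q C′ v∈C))) u∈A-v)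
        (x∉p-x (C ∪ C′) v)

-- Enumeration without repetition, unions of lists, and indicator vectors

allSubsets-unique : ∀ n → Unique (allSubsets n)
allSubsets-unique zero    = All.[] ∷ []
allSubsets-unique (suc n) = Uniqueₚ.++⁺
  (Uniqueₚ.map⁺ ∷-injectiveʳ (allSubsets-unique n))
  (Uniqueₚ.map⁺ ∷-injectiveʳ (allSubsets-unique n))
  λ (∈outside , ∈inside) → heads-differ (∈-map⁻ _ ∈outside) (∈-map⁻ _ ∈inside)
  where
  heads-differ : ∀ {F : Subset (suc n)} → (∃[ G ] G ListMem.∈ allSubsets n × F ≡ outside Vec.∷ G) →
    ¬ (∃[ G ] G ListMem.∈ allSubsets n × F ≡ inside Vec.∷ G)
  heads-differ (_ , _ , ≡.refl) (_ , _ , ())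

-- For a list without repetitions, such as that of the circuits, distinct indices then stand for
-- distinct entries, as coprimality for i ≠ j demands.
lookup-injective : ∀ {a} {A : Set a} {xs : List A} → Unique xs → ∀ {i j} → List.lookup xs i ≡ List.lookup xs j → i ≡ j
lookup-injective (_    ∷ _)   {zero}  {zero}  _ = ≡.refl
lookup-injective (x∉xs ∷ _)   {zero}  {suc j} e = contradiction e (All.lookup x∉xs (∈-lookup j))
lookup-injective (x∉xs ∷ _)   {suc i} {zero}  e = contradiction (≡.sym e) (All.lookup x∉xs (∈-lookup i))
lookup-injective (_    ∷ xs!) {suc i} {suc j} e = ≡.cong suc (lookup-injective xs! e)

∈-⋃⁺ : ∀ {n} {ps : List (Subset n)} {p} → p ListMem.∈ ps → p ⊆ ⋃ ps
∈-⋃⁺ {ps = p ∷ ps} (Any.here ≡.refl) = Sub.p⊆p∪q (⋃ ps)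
∈-⋃⁺ {ps = q ∷ ps} (Any.there p∈ps)  = Sub.q⊆p∪q q (⋃ ps) ∘ ∈-⋃⁺ p∈ps

∈-⋃⁻ : ∀ {n} (ps : List (Subset n)) {x} → x ∈ ⋃ ps → ∃[ i ] x ∈ List.lookup ps i
∈-⋃⁻ []       x∈⊥ = contradiction x∈⊥ Sub.∉⊥
∈-⋃⁻ (p ∷ ps) x∈ with Sub.x∈p∪q⁻ p (⋃ ps) x∈
... | inj₁ x∈p  = zero , x∈p
... | inj₂ x∈ps = let i , x∈psᵢ = ∈-⋃⁻ ps x∈ps in suc i , x∈psᵢ

-- Spelled as in `𝐱^`, so that `monomial (indicator F)` is `𝐱^ F` by definition.
indicator : ∀ {n} → Subset n → Vec ℕ n
indicator = Vec.map (λ b → if b then 1 else 0)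

lookup-indicator-∈ : ∀ {n} {F : Subset n} {v} → v ∈ F → lookup (indicator F) v ≡ 1
lookup-indicator-∈ {F = F} {v} v∈F = ≡.trans (lookup-map v _ F) (≡.cong (if_then 1 else 0) ([]=⇒lookup v∈F))

lookup-indicator-∉ : ∀ {n} {F : Subset n} {v} → v ∉ F → lookup (indicator F) v ≡ 0
lookup-indicator-∉ {F = F} {v} v∉F with lookup F v in eq
... | inside  = contradiction (lookup⇒[]= v F eq) v∉F
... | outside = ≡.trans (lookup-map v _ F) (≡.cong (if_then 1 else 0) eq)

-- Coprime cofactors of the circuits in corank at most two

module MatroidCircuits {n : ℕ} (M : Matroid n) (corank≤2 : Matroid.corank M ≤ 2) where
  open Matroid M
  open Circuits M
  open Exponents n

  circuits : List (Subset n)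
  circuits = minimalNonfaces complex

  C : Fin (length circuits) → Subset n
  C = List.lookup circuits

  C-circuit : ∀ i → Circuit (C i)
  C-circuit i = proj₂ (∈-filter⁻ (minimalNonface? complex) {xs = allSubsets n} (∈-lookup {xs = circuits} i))

  C-injective : ∀ {i j} → C i ≡ C j → i ≡ j
  C-injective = lookup-injective (Uniqueₚ.filter⁺ (minimalNonface? complex) (allSubsets-unique n))

  c : Vector Exponent (length circuits)
  c i = indicator (C i)

  u : Exponent
  u = indicator (⋃ circuits)

  q : Vector Exponent (length circuits)
  q i = u ⊖ c i

  c≼u : ∀ i → c i ≼ u
  c≼u i v with v Sub.∈? C i
  ... | yes v∈C = ℕₚ.≤-reflexive (≡.trans (lookup-indicator-∈ v∈C)
    (≡.sym (lookup-indicator-∈ (∈-⋃⁺ (∈-lookup {xs = circuits} i) v∈C))))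
  ... | no  v∉C = ≡.subst (_≤ lookup u v) (≡.sym (lookup-indicator-∉ v∉C)) ℕ.z≤n

  q⊕c≡u : ∀ i → q i ⊕ c i ≡ u
  q⊕c≡u i = ≡.trans (zipWith-comm ℕₚ.+-comm (q i) (c i)) (⊕-⊖ (c≼u i))

  lookup-q-∈ : ∀ i {v} → v ∈ C i → lookup (q i) v ≡ 0
  lookup-q-∈ i {v} v∈C = ≡.trans (lookup-⊖ u (c i) v) (≡.cong₂ _∸_
    (lookup-indicator-∈ (∈-⋃⁺ (∈-lookup {xs = circuits} i) v∈C)) (lookup-indicator-∈ v∈C))

  -- A common variable would be a point of some circuit Cₗ outside both Cᵢ and Cⱼ, which
  -- `circuit-⊆-union` excludes.
  coprime : ∀ i j → i ≢ j → ∀ v → lookup (q i) v ≡ 0 ⊎ lookup (q j) v ≡ 0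
  coprime i j i≢j v with v Sub.∈? C i | v Sub.∈? C j
  ... | yes v∈Cᵢ | _        = inj₁ (lookup-q-∈ i v∈Cᵢ)
  ... | no  _    | yes v∈Cⱼ = inj₂ (lookup-q-∈ j v∈Cⱼ)
  ... | no v∉Cᵢ  | no v∉Cⱼ  = inj₁ (≡.trans (lookup-⊖ u (c i) v)
    (≡.trans (≡.cong (_∸ lookup (c i) v) (lookup-indicator-∉ v∉⋃)) (ℕₚ.0∸n≡0 (lookup (c i) v))))
    where
    v∉⋃ : v ∉ ⋃ circuits
    v∉⋃ v∈⋃ = let l , v∈Cₗ = ∈-⋃⁻ circuits v∈⋃ in [ v∉Cᵢ , v∉Cⱼ ]′ (Sub.x∈p∪q⁻ (C i) (C j)
      (circuit-⊆-union corank≤2 (C-circuit i) (C-circuit j) (i≢j ∘ C-injective) (C-circuit l) v∈Cₗ))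

-- The Stanley-Reisner ideal of the matroid

module _ {c ℓ₁ ℓ₂ : Level} (K : HeytingField c ℓ₁ ℓ₂) (n : ℕ) (M : Matroid n) (corank≤2 : Matroid.corank M ≤ 2) where
  open StanleyReisner K (Matroid.complex M)
  open MatroidCircuits M corank≤2 using (q; u; q⊕c≡u; coprime) renaming (c to circuitExponent)
  private
    R = HeytingCommutativeRing.commutativeRing (HeytingField.heytingCommutativeRing K)
  open Polynomial R n using (Poly; monomial; *ᴾ-comm)
  open Coefficients R n using (div; glue; monomial-regular; module CoprimeMonomials)
  open CoprimeMonomials circuitExponent q u q⊕c≡u coprime
  private
    module S = CommutativeRing S
  open Quotient I_Δ using (_∼_)

  u-regular : ∀ P → P S.* monomial u S.≈ S.0# → P S.≈ S.0#
  u-regular P Pu≈0 = monomial-regular u (S.trans (*ᴾ-comm (monomial u) P) Pu≈0)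

  q-divides : ∀ h → ⟦ linearCombination {R = S} generator ⟧ h S.≈ S.0# →
    Σ[ b ∈ Vector Poly #generators ] (∀ i → h i S.≈ monomial (q i) S.* b i)
  q-divides h d[h]≈0 = (λ i → div (q i) (h i)) , syzygy-divisible h d[h]≈0

  D*q≈c : ∀ i j (i≢j : i ≢ j) → D i j i≢j S.* monomial (q i) S.≈ generator j × D i j i≢j S.* monomial (q j) S.≈ generator i
  D*q≈c i j i≢j = monomial-⊕ (proj₁ (c⊖q⊕q≡c i j i≢j)) , monomial-⊕ (proj₂ (c⊖q⊕q≡c i j i≢j))

  -- `I⊆⟨generators⟩` unpacks membership in `I_Δ` into an explicit combination of the x^Cₗ, whose
  -- coefficients can be compared.
  crt : (t : Vector Poly #generators) → (∀ i j i≢j → (D i j i≢j S.* t i) ∼ (D i j i≢j S.* t j)) →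
    Σ[ t₀ ∈ Poly ] Σ[ a ∈ Vector Poly #generators ] (∀ i → t i S.≈ t₀ S.+ monomial (q i) S.* a i)
  crt t compatible = glue q t , (λ i → div (q i) (t i S.- glue q t)) ,
    chinese-remainder t (λ i j i≢j → I⊆⟨generators⟩ (Quotient._∼_.difference (compatible i j i≢j)))

  q*c≈u : ∀ i → monomial (q i) S.* generator i S.≈ monomial u
  q*c≈u i = monomial-⊕ (q⊕c≡u i)

  -- With a type signature, Agda would compare the two modules up to the
  -- η-expansion of I⊆⟨generators⟩ at its implicit argument, by unfolding both.
  vanishing = CoprimeCofactors.T²-vanishes S I_Δ generator generator∈I (λ P → I⊆⟨generators⟩ {P})
    (monomial ∘ q) (monomial u) q*c≈u u-regular q-divides D D*q≈c crt

proposition5p1 : ∀ {c ℓ₁ ℓ₂ : Level} (K : HeytingField c ℓ₁ ℓ₂) (n : ℕ) (M : Matroid n) →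
    Matroid.corank M ≤ 2 → IsZero (T² K (Matroid.complex M))
proposition5p1 K n M corank≤2 = vanishing K n M corank≤2
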